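{- Suppose $f(x)\in\mathbb{R}[x]$ is monic and separable of degree $n\geq 2$ and signature $(t,s)$, where $s=0$, or $(t,s)=(1,1)$, or $(t,s)=(0,2)$. Then \[\operatorname{sep}(f)\leq C_{t,s}\,M(f)^{1/(n-\delta)},\] where $\delta=1$ if $t\neq 0$ and $\delta=0$ if $t=0$, and where $C_{1,1}=\sqrt{3}$, $C_{0,2}=\sqrt{2}$, and $C_{t,0}=(2e+o(1))/t$. Here $o(1)$ denotes a quantity depending only on $t$ that tends to $0$ as $t\to\infty$; that is, there is a function $\varepsilon:\{2,3,\dots\}\to\mathbb{R}$ with $\varepsilon(t)\to 0$ as $t\to\infty$ such that the inequality holds with $C_{t,0}=(2e+\varepsilon(t))/t$ for every $t\geq 2$ and every such $f$ of signature $(t,0)$.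
   Context: For a polynomial $f(x)\in\mathbb{C}[x]$ with roots $\alpha_1,\dots,\alpha_n\in\mathbb{C}$, the separation of $f$ is $\operatorname{sep}(f) := \min_{\alpha_i\neq\alpha_j}|\alpha_i-\alpha_j|$. For a monic polynomial $f(x)\in\mathbb{C}[x]$ with roots $\alpha_1,\dots,\alpha_n$ (with multiplicity), the Mahler measure of $f$ is $M(f) := \prod_{i=1}^n\max\{1,|\alpha_i|\}$. Separable means that $f$ has $n=\deg f$ distinct complex roots. A polynomial $f(x)\in\mathbb{R}[x]$ has signature $(t,s)$ if it has $t$ real roots and $s$ pairs of complex conjugate (nonreal) roots, so that $n=t+2s$. -}

module Defs where

open import Algebra.Bundles using (CommutativeRing)
open import Algebra.Bundles.Raw using (RawRing)
open import Algebra.Definitions using (Invertible)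
import Algebra.Construct.NaturalChoice.Max as Max
import Algebra.Definitions.RawSemiring as RawSemiringDefs
open import Axiom.ExcludedMiddle using (ExcludedMiddle)
open import Data.Fin.Base using (Fin)
open import Data.List.Base as List using (List; []; _∷_; _++_; foldr; map)
open import Data.Nat.Base as ℕ using (ℕ; zero; suc; _!)
open import Data.Product.Base using (∃; ∃-syntax; Σ-syntax; _×_; _,_; proj₁)
open import Data.Vec.Base as Vec using (Vec; toList)
open import Data.Vec.Relation.Unary.All using (All)
open import Function.Definitions using (Injective)
open import Level using (0ℓ)
open import Relation.Binary.Bundles using (TotalOrder)
open import Relation.Binary.Core using (Rel)
import Relation.Binary.Construct.NonStrictToStrict as ToStrict
open import Relation.Binary.PropositionalEquality.Core using (_≡_)
open import Relation.Binary.Structures using (IsTotalOrder)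
open import Relation.Nullary.Decidable.Core using (yes; no)
open import Relation.Nullary.Negation.Core using (¬_)

-- The standard library has no real numbers.  They are taken to be an
-- arbitrary complete ordered field (unique up to unique isomorphism).
record CompleteOrderedField : Set₁ where
  infix 4 _≤_
  field
    commutativeRing : CommutativeRing 0ℓ 0ℓ

  open CommutativeRing commutativeRing public

  field
    _≤_          : Rel Carrier 0ℓ
    isTotalOrder : IsTotalOrder _≈_ _≤_
    0≉1          : ¬ (0# ≈ 1#)
    invertible   : ∀ x → ¬ (x ≈ 0#) → Invertible _≈_ 1# _*_ x
    +-monoʳ-≤    : ∀ z {x y} → x ≤ y → (z + x) ≤ (z + y)
    *-nonNeg     : ∀ {x y} → 0# ≤ x → 0# ≤ y → 0# ≤ (x * y)

  IsUpperBound : (Carrier → Set) → Carrier → Set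
  IsUpperBound P b = ∀ x → P x → x ≤ b

  IsLUB : (Carrier → Set) → Carrier → Set
  IsLUB P b = IsUpperBound P b × (∀ c → IsUpperBound P c → b ≤ c)

  field
    complete : ∀ P → ∃ P → ∃ (IsUpperBound P) → ∃ (IsLUB P)

  totalOrder : TotalOrder 0ℓ 0ℓ 0ℓ
  totalOrder = record { isTotalOrder = isTotalOrder }

  open Max totalOrder public using (_⊔_)
  open ToStrict _≈_ _≤_ public using (_<_)

-- Polynomials are lists of coefficients, constant term first; lists that
-- differ by trailing zeros represent the same polynomial.
module Polynomials (K : RawRing 0ℓ 0ℓ) where
  open RawRing K

  Poly : Set
  Poly = List Carrier

  coeff : Poly → ℕ → Carrier
  coeff []      _       = 0#
  coeff (a ∷ p) zero    = a
  coeff (a ∷ p) (suc k) = coeff p k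

  infix 4 _≋_
  _≋_ : Poly → Poly → Set
  p ≋ q = ∀ k → coeff p k ≈ coeff q k

  MonicOfDegree : ℕ → Poly → Set
  MonicOfDegree n p = coeff p n ≈ 1# × (∀ k → n ℕ.< k → coeff p k ≈ 0#)

  eval : Poly → Carrier → Carrier
  eval []      x = 0#
  eval (a ∷ p) x = a + x * eval p x

  infixl 6 _⊕_
  _⊕_ : Poly → Poly → Poly
  []      ⊕ q       = q
  (a ∷ p) ⊕ []      = a ∷ p
  (a ∷ p) ⊕ (b ∷ q) = (a + b) ∷ (p ⊕ q)

  infixl 7 _⊗_
  _⊗_ : Poly → Poly → Poly
  []      ⊗ q = []
  (a ∷ p) ⊗ q = map (a *_) q ⊕ (0# ∷ (p ⊗ q))

  -- ∏ᵢ (x - αᵢ)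
  fromRoots : List Carrier → Poly
  fromRoots = foldr (λ α p → ((- α) ∷ 1# ∷ []) ⊗ p) (1# ∷ [])

-- Excluded middle is the classical logic of ordinary analysis.
module Analysis (lem : ExcludedMiddle 0ℓ) (R : CompleteOrderedField) where
  open CompleteOrderedField R public renaming (Carrier to ℝ)
  open RawSemiringDefs (RawRing.rawSemiring (CommutativeRing.rawRing commutativeRing))
    using (_^_) renaming (_×_ to _·_)

  -- Definite description, used only for P satisfied by exactly one real
  -- number up to ≈; the value 0 is junk for P with no witness.
  the : (ℝ → Set) → ℝ
  the P with lem {P = ∃ P}
  ... | yes (x , _) = x
  ... | no  _       = 0#

  fromℕ : ℕ → ℝ
  fromℕ n = n · 1#

  infixl 7 _/_
  _/_ : ℝ → ℝ → ℝ
  x / y = the λ z → z * y ≈ x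

  abs : ℝ → ℝ
  abs x = x ⊔ (- x)

  -- a ^1/ k is the nonnegative k-th root of a, meaningful for a ≥ 0 and k ≥ 1
  infixr 8 _^1/_
  _^1/_ : ℝ → ℕ → ℝ
  a ^1/ k = the λ x → 0# ≤ x × x ^ k ≈ a

  √_ : ℝ → ℝ
  √ a = a ^1/ 2

  infix 4 _⟶_
  _⟶_ : (ℕ → ℝ) → ℝ → Set
  u ⟶ l = ∀ η → 0# < η → ∃[ N ] (∀ n → N ℕ.≤ n → abs (u n - l) < η)

  expSum : ℕ → ℝ
  expSum zero    = 1#
  expSum (suc N) = expSum N + 1# / fromℕ (suc N !)

  e : ℝ
  e = the λ x → expSum ⟶ x

  record ℂ : Set where
    constructor _+i_
    field
      re im : ℝ
  open ℂ public

  ℂ-rawRing : RawRing 0ℓ 0ℓ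
  ℂ-rawRing = record
    { Carrier = ℂ
    ; _≈_ = λ z w → re z ≈ re w × im z ≈ im w
    ; _+_ = λ z w → (re z + re w) +i (im z + im w)
    ; _*_ = λ z w → (re z * re w - im z * im w) +i (re z * im w + im z * re w)
    ; -_  = λ z → (- re z) +i (- im z)
    ; 0#  = 0# +i 0#
    ; 1#  = 1# +i 0#
    }

  open RawRing ℂ-rawRing public using ()
    renaming (_≈_ to _≈ᶜ_; _+_ to _+ᶜ_; -_ to -ᶜ_; 0# to 0ᶜ)

  ofReal : ℝ → ℂ
  ofReal x = x +i 0#

  conj : ℂ → ℂ
  conj z = re z +i (- im z)

  ∣_∣ : ℂ → ℝ
  ∣ z ∣ = √ (re z * re z + im z * im z)

  module ℝ[x] = Polynomials (CommutativeRing.rawRing commutativeRing)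
  module ℂ[x] = Polynomials ℂ-rawRing

  toℂ[x] : ℝ[x].Poly → ℂ[x].Poly
  toℂ[x] = map ofReal

  IsRoot : ℝ[x].Poly → ℂ → Set
  IsRoot f z = ℂ[x].eval (toℂ[x] f) z ≈ᶜ 0ᶜ

  -- αs lists the complex roots of the monic polynomial f with multiplicity
  HasRoots : ℝ[x].Poly → List ℂ → Set
  HasRoots f αs = toℂ[x] f ℂ[x].≋ ℂ[x].fromRoots αs

  -- n is the degree of f
  Separable : ℕ → ℝ[x].Poly → Set
  Separable n f =
    Σ[ α ∈ (Fin n → ℂ) ] (∀ i → IsRoot f (α i)) × Injective _≡_ _≈ᶜ_ α

  HasSignature : ℝ[x].Poly → ℕ → ℕ → Set
  HasSignature f t s =
    Σ[ r ∈ Vec ℝ t ] Σ[ z ∈ Vec ℂ s ]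
      All (λ w → ¬ (im w ≈ 0#)) z ×
      HasRoots f (map ofReal (toList r) ++ toList z ++ map conj (toList z))

  IsMinimum : (ℝ → Set) → ℝ → Set
  IsMinimum P d = P d × (∀ x → P x → d ≤ x)

  RootDistance : ℝ[x].Poly → ℝ → Set
  RootDistance f d =
    ∃[ α ] ∃[ β ] IsRoot f α × IsRoot f β × ¬ (α ≈ᶜ β) × d ≈ ∣ α +ᶜ (-ᶜ β) ∣

  sep : ℝ[x].Poly → ℝ
  sep f = the (IsMinimum (RootDistance f))

  mahlerOfRoots : List ℂ → ℝ
  mahlerOfRoots = foldr (λ α m → (1# ⊔ ∣ α ∣) * m) 1#

  -- the Mahler measure of a monic polynomial
  M : ℝ[x].Poly → ℝ
  M f = the λ m → ∃[ αs ] HasRoots f αs × m ≈ mahlerOfRoots αs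

  data Case : ℕ → ℕ → Set where
    totallyReal : ∀ {t} → Case t 0
    case-1,1    : Case 1 1
    case-0,2    : Case 0 2

  δ : ℕ → ℕ
  δ zero    = 0
  δ (suc _) = 1

  -- ε is the o(1) term
  C : (ε : ℕ → ℝ) → ∀ {t s} → Case t s → ℝ
  C ε (totallyReal {t}) = (fromℕ 2 * e + ε t) / fromℕ t
  C ε case-1,1          = √ (fromℕ 3)
  C ε case-0,2          = √ (fromℕ 2)

{-# OPTIONS --safe #-}

-- Totally real case, with ε = 0: let d = sep f and order the n roots by modulus.
-- The k + 1 roots of smallest modulus lie in an interval of length 2 |x|, where x is the
-- largest of them, so k d ≤ 2 |x|.  Multiplying over k < n gives (d / 2)ⁿ⁻¹ (n - 1)! ≤ M f,
-- and nⁿ⁻¹ ≤ (n - 1)! eⁿ⁻¹ because (1 + 1/k)ᵏ ≤ e.  For the signatures (1,1) and (0,2) the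
-- squared distances between the roots are compared with M f by polynomial identities.

module Submission where

open import Defs
open import Algebra.Bundles using (CommutativeRing; RawRing)
import Algebra.Construct.NaturalChoice.Max as Max
import Algebra.Properties.CommutativeSemiring.Exp as Exp
import Algebra.Properties.Ring as RingProperties
import Algebra.Properties.Semiring.Mult as Mult
import Algebra.Properties.Semiring.Mult.TCOptimised as TCMult
import Algebra.Solver.Ring as RingSolver
open import Algebra.Solver.Ring.AlmostCommutativeRing
  using (_-Raw-AlmostCommutative⟶_; fromCommutativeRing)
open import Algebra.Structures using (IsCommutativeRing)
open import Axiom.ExcludedMiddle using (ExcludedMiddle)
open import Data.Fin.Base using (Fin)
import Data.Fin.Properties as Fin
open import Data.Integer.Base as ℤ using (ℤ; +_; -[1+_]; _⊖_; _◃_)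
import Data.Integer.Properties as ℤ
open import Data.List.Base as List using (List; []; _∷_; _++_; map; length)
import Data.List.Properties as List
open import Data.List.Relation.Binary.Permutation.Propositional as ↭ using (_↭_; ↭⇒↭ₛ)
open import Data.List.Relation.Binary.Permutation.Propositional.Properties
  using (All-resp-↭; ↭-length)
import Data.List.Relation.Binary.Permutation.Setoid.Properties as ↭ₛ
open import Data.List.Relation.Unary.All as All using (All; []; _∷_)
import Data.List.Relation.Unary.All.Properties as All
open import Data.List.Relation.Unary.AllPairs as AllPairs using (AllPairs; []; _∷_)
import Data.List.Relation.Unary.AllPairs.Properties as AllPairs
open import Data.List.Relation.Unary.Any as Any using (Any; here; there)
import Data.List.Relation.Unary.Any.Properties as Any
open import Data.Maybe.Base using (Maybe; just; nothing)
open import Data.Nat.Base as ℕ using (ℕ; zero; suc; _∸_)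
import Data.Nat.Properties as ℕ
open import Data.Product.Base using (∃; ∃-syntax; ∃₂; Σ-syntax; _×_; _,_; proj₁; proj₂)
import Data.Sign.Base as Sign
open import Data.Sum.Base using (_⊎_; inj₁; inj₂; reduce)
open import Data.Vec.Base as Vec using ([]; _∷_)
import Data.Vec.Relation.Unary.All as VecAll
open import Function.Base using (_∘_; case_of_)
open import Function.Definitions using (Injective)
open import Level using (0ℓ)
open import Relation.Binary.Bundles using (TotalOrder)
open import Relation.Binary.Core using (Rel)
open import Relation.Binary.Definitions using (Symmetric)
open import Relation.Binary.PropositionalEquality as ≡ using (_≡_)
import Relation.Binary.Reasoning.PartialOrder as ≤-Reasoning
import Relation.Binary.Reasoning.Setoid as ≈-Reasoning
open import Relation.Nullary.Decidable.Core using (yes; no; decidable-stable)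
open import Relation.Nullary.Negation.Core using (¬_; contradiction)

-- In the totally real case the exponent n - 1 is due to the root of smallest modulus: it comes with
-- no gap, so only the other n - 1 roots contribute a factor of the separation, and its own Mahler
-- factor is just bounded below by 1. Since the factorial estimate holds for every n, the o(1) term
-- can vanish identically.
--
-- The constants √3 and √2 are attained by x³ - 1 and x⁴ + 1, both of Mahler measure 1, so the
-- estimates covering these roots can have no slack there.
--
-- `sep` and `M` are definite descriptions. Apart from nonnegativity they are used in one direction
-- each: `sep f` is at most every distance between distinct roots, and `M f` is at least the product
-- of the Mahler factors over any list of distinct roots. The second fact stands in for the
-- uniqueness of the list of roots up to permutation.

-- Polynomial identities in a commutative ring, normalised over ℤ

module IntegerCoefficients (K : CommutativeRing 0ℓ 0ℓ) where
  open CommutativeRing K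
  open RingProperties ring
  open TCMult semiring using (×-homo-+; ×1-homo-*) renaming (_×_ to _·_)
  open ≈-Reasoning setoid

  private
    ⟦_⟧ : ℤ → Carrier
    ⟦ + n ⟧      = n · 1#
    ⟦ -[1+ n ] ⟧ = - (suc n · 1#)

    cancel-1 : ∀ x y → (1# + x) - (1# + y) ≈ x - y
    cancel-1 x y = begin
      (1# + x) - (1# + y)      ≈⟨ +-congˡ (-‿+-comm 1# y) ⟨
      (1# + x) + (- 1# + - y)  ≈⟨ +-congʳ (+-comm 1# x) ⟩
      (x + 1#) + (- 1# + - y)  ≈⟨ +-assoc x 1# _ ⟩
      x + (1# + (- 1# + - y))  ≈⟨ +-congˡ (+-assoc 1# (- 1#) (- y)) ⟨
      x + ((1# + - 1#) + - y)  ≈⟨ +-congˡ (+-congʳ (-‿inverseʳ 1#)) ⟩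
      x + (0# + - y)           ≈⟨ +-congˡ (+-identityˡ (- y)) ⟩
      x - y                    ∎

    ⊖-homo : ∀ m n → ⟦ m ⊖ n ⟧ ≈ m · 1# - n · 1#
    ⊖-homo m zero = begin
      m · 1#         ≈⟨ +-identityʳ _ ⟨
      m · 1# + 0#    ≈⟨ +-congˡ -0#≈0# ⟨
      m · 1# - 0#    ∎
    ⊖-homo zero (suc n) = sym (+-identityˡ _)
    ⊖-homo (suc m) (suc n) rewrite ℤ.[1+m]⊖[1+n]≡m⊖n m n = begin
      ⟦ m ⊖ n ⟧                        ≈⟨ ⊖-homo m n ⟩
      m · 1# - n · 1#                  ≈⟨ cancel-1 _ _ ⟨
      (1# + m · 1#) - (1# + n · 1#)    ≈⟨ +-cong (×-homo-+ 1# 1 m) (-‿cong (×-homo-+ 1# 1 n)) ⟨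
      suc m · 1# - suc n · 1#          ∎

    +-homo : ∀ i j → ⟦ i ℤ.+ j ⟧ ≈ ⟦ i ⟧ + ⟦ j ⟧
    +-homo (+ m)    (+ n)    = ×-homo-+ 1# m n
    +-homo (+ m)    -[1+ n ] = ⊖-homo m (suc n)
    +-homo -[1+ m ] (+ n)    = trans (⊖-homo n (suc m)) (+-comm _ _)
    +-homo -[1+ m ] -[1+ n ] = begin
      - (suc (suc (m ℕ.+ n)) · 1#)        ≡⟨ ≡.cong (λ k → - (k · 1#)) (≡.sym (ℕ.+-suc (suc m) n)) ⟩
      - ((suc m ℕ.+ suc n) · 1#)          ≈⟨ -‿cong (×-homo-+ 1# (suc m) (suc n)) ⟩
      - (suc m · 1# + suc n · 1#)         ≈⟨ -‿+-comm _ _ ⟨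
      - (suc m · 1#) + - (suc n · 1#)     ∎

    -◃-homo : ∀ n → ⟦ Sign.- ◃ n ⟧ ≈ - (n · 1#)
    -◃-homo zero    = sym -0#≈0#
    -◃-homo (suc n) = refl

    *-homo : ∀ i j → ⟦ i ℤ.* j ⟧ ≈ ⟦ i ⟧ * ⟦ j ⟧
    *-homo (+ m) (+ n) = begin
      ⟦ Sign.+ ◃ m ℕ.* n ⟧   ≡⟨ ≡.cong ⟦_⟧ (ℤ.+◃n≡+n (m ℕ.* n)) ⟩
      (m ℕ.* n) · 1#         ≈⟨ ×1-homo-* m n ⟩
      (m · 1#) * (n · 1#)    ∎
    *-homo (+ m) -[1+ n ] = begin
      ⟦ Sign.- ◃ m ℕ.* suc n ⟧      ≈⟨ -◃-homo (m ℕ.* suc n) ⟩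
      - ((m ℕ.* suc n) · 1#)        ≈⟨ -‿cong (×1-homo-* m (suc n)) ⟩
      - ((m · 1#) * (suc n · 1#))   ≈⟨ -‿distribʳ-* _ _ ⟩
      (m · 1#) * - (suc n · 1#)     ∎
    *-homo -[1+ m ] (+ n) = begin
      ⟦ Sign.- ◃ suc m ℕ.* n ⟧      ≈⟨ -◃-homo (suc m ℕ.* n) ⟩
      - ((suc m ℕ.* n) · 1#)        ≈⟨ -‿cong (×1-homo-* (suc m) n) ⟩
      - ((suc m · 1#) * (n · 1#))   ≈⟨ -‿distribˡ-* _ _ ⟩
      - (suc m · 1#) * (n · 1#)     ∎
    *-homo -[1+ m ] -[1+ n ] = begin
      (suc m ℕ.* suc n) · 1#                ≈⟨ ×1-homo-* (suc m) (suc n) ⟩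
      (suc m · 1#) * (suc n · 1#)           ≈⟨ -‿involutive _ ⟨
      - - ((suc m · 1#) * (suc n · 1#))     ≈⟨ -‿cong (-‿distribˡ-* _ _) ⟩
      - (- (suc m · 1#) * (suc n · 1#))     ≈⟨ -‿distribʳ-* _ _ ⟩
      - (suc m · 1#) * - (suc n · 1#)       ∎

    -‿homo : ∀ i → ⟦ ℤ.- i ⟧ ≈ - ⟦ i ⟧
    -‿homo (+ zero)  = sym -0#≈0#
    -‿homo (+ suc n) = refl
    -‿homo -[1+ n ]  = sym (-‿involutive _)

    -- The solver compares coefficients computationally, which the abstract carrier does not allow.
    -- Integers do, and they map into every commutative ring.
    morphism : ℤ.+-*-rawRing -Raw-AlmostCommutative⟶ fromCommutativeRing K
    morphism = record
      { ⟦_⟧    = ⟦_⟧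
      ; +-homo = +-homo
      ; *-homo = *-homo
      ; -‿homo = -‿homo
      ; 0-homo = refl
      -- The optimised multiple `1 · 1#` reduces to `1#`, so `:1` denotes `1#` itself.
      ; 1-homo = refl
      }

    _coeff≟_ : ∀ i j → Maybe (⟦ i ⟧ ≈ ⟦ j ⟧)
    i coeff≟ j with i ℤ.≟ j
    ... | yes i≡j = just (reflexive (≡.cong ⟦_⟧ i≡j))
    ... | no  _   = nothing

  open RingSolver ℤ.+-*-rawRing (fromCommutativeRing K) morphism _coeff≟_ public
    using (Polynomial; solve; _:=_; _:+_; _:*_; _:-_; _:^_; :-_; con)

  :0 : ∀ {n} → Polynomial n
  :0 = con (+ 0)

  :1 : ∀ {n} → Polynomial n
  :1 = con (+ 1)

  -- Spelled out as 1 + (1 + ... + 0), which is how `fromℕ` unfolds, so that the two agree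
  -- definitionally and solver equations apply to goals that mention `fromℕ`.
  :fromℕ : ∀ {n} → ℕ → Polynomial n
  :fromℕ zero    = :0
  :fromℕ (suc n) = :1 :+ :fromℕ n

-- Evaluation of coefficient lists and the roots of a product of linear factors

module PolynomialEvaluation (K : CommutativeRing 0ℓ 0ℓ) where
  open CommutativeRing K
  open Polynomials rawRing
  open IntegerCoefficients K
  open ≈-Reasoning setoid

  -- Lists related by `≋` may differ in length; this disposes of the trailing zeros of the longer
  -- one in `eval-cong`.
  eval-zero : ∀ p x → (∀ k → coeff p k ≈ 0#) → eval p x ≈ 0#
  eval-zero []      x p≈0 = refl
  eval-zero (a ∷ p) x p≈0 = begin
    a + x * eval p x  ≈⟨ +-cong (p≈0 0) (*-congˡ (eval-zero p x (p≈0 ∘ suc))) ⟩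
    0# + x * 0#       ≈⟨ solve 1 (λ x → :0 :+ x :* :0 := :0) refl x ⟩
    0#                ∎

  eval-cong : ∀ p q x → p ≋ q → eval p x ≈ eval q x
  eval-cong []      q       x p≋q = sym (eval-zero q x (sym ∘ p≋q))
  eval-cong (a ∷ p) []      x p≋q = eval-zero (a ∷ p) x p≋q
  eval-cong (a ∷ p) (b ∷ q) x p≋q =
    +-cong (p≋q 0) (*-congˡ (eval-cong p q x (p≋q ∘ suc)))

  eval-⊕ : ∀ p q x → eval (p ⊕ q) x ≈ eval p x + eval q x
  eval-⊕ []      q       x = sym (+-identityˡ _)
  eval-⊕ (a ∷ p) []      x = sym (+-identityʳ _)
  eval-⊕ (a ∷ p) (b ∷ q) x = begin
    (a + b) + x * eval (p ⊕ q) x             ≈⟨ +-congˡ (*-congˡ (eval-⊕ p q x)) ⟩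
    (a + b) + x * (eval p x + eval q x)      ≈⟨ solve 5 (λ a b x u v →
      (a :+ b) :+ x :* (u :+ v) := (a :+ x :* u) :+ (b :+ x :* v)) refl a b x _ _ ⟩
    (a + x * eval p x) + (b + x * eval q x)  ∎

  eval-scale : ∀ a p x → eval (map (a *_) p) x ≈ a * eval p x
  eval-scale a []      x = sym (zeroʳ a)
  eval-scale a (b ∷ p) x = begin
    a * b + x * eval (map (a *_) p) x  ≈⟨ +-congˡ (*-congˡ (eval-scale a p x)) ⟩
    a * b + x * (a * eval p x)         ≈⟨ solve 4 (λ a b x u →
      a :* b :+ x :* (a :* u) := a :* (b :+ x :* u)) refl a b x _ ⟩
    a * (b + x * eval p x)             ∎

  eval-⊗ : ∀ p q x → eval (p ⊗ q) x ≈ eval p x * eval q x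
  eval-⊗ []      q x = sym (zeroˡ _)
  eval-⊗ (a ∷ p) q x = begin
    eval (map (a *_) q ⊕ (0# ∷ p ⊗ q)) x
      ≈⟨ eval-⊕ (map (a *_) q) (0# ∷ p ⊗ q) x ⟩
    eval (map (a *_) q) x + (0# + x * eval (p ⊗ q) x)
      ≈⟨ +-cong (eval-scale a q x) (+-congˡ (*-congˡ (eval-⊗ p q x))) ⟩
    a * eval q x + (0# + x * (eval p x * eval q x))
      ≈⟨ solve 4 (λ a x u v → a :* v :+ (:0 :+ x :* (u :* v)) := (a :+ x :* u) :* v) refl a x _ _ ⟩
    (a + x * eval p x) * eval q x
      ∎

  eval-fromRoots-∷ : ∀ α αs x → eval (fromRoots (α ∷ αs)) x ≈ (x - α) * eval (fromRoots αs) x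
  eval-fromRoots-∷ α αs x = begin
    eval (((- α) ∷ 1# ∷ []) ⊗ fromRoots αs) x
      ≈⟨ eval-⊗ ((- α) ∷ 1# ∷ []) (fromRoots αs) x ⟩
    (- α + x * (1# + x * 0#)) * eval (fromRoots αs) x
      ≈⟨ *-congʳ (solve 2 (λ α x → :- α :+ x :* (:1 :+ x :* :0) := x :- α) refl α x) ⟩
    (x - α) * eval (fromRoots αs) x
      ∎

  ∈⇒eval-fromRoots≈0 : ∀ {x αs} → Any (x ≈_) αs → eval (fromRoots αs) x ≈ 0#
  ∈⇒eval-fromRoots≈0 {x} {α ∷ αs} (here x≈α) = begin
    eval (fromRoots (α ∷ αs)) x      ≈⟨ eval-fromRoots-∷ α αs x ⟩
    (x - α) * eval (fromRoots αs) x  ≈⟨ *-congʳ (+-congʳ x≈α) ⟩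
    (α - α) * eval (fromRoots αs) x  ≈⟨ solve 2 (λ α u → (α :- α) :* u := :0) refl α _ ⟩
    0#                               ∎
  ∈⇒eval-fromRoots≈0 {x} {α ∷ αs} (there x∈αs) = begin
    eval (fromRoots (α ∷ αs)) x      ≈⟨ eval-fromRoots-∷ α αs x ⟩
    (x - α) * eval (fromRoots αs) x  ≈⟨ *-congˡ (∈⇒eval-fromRoots≈0 x∈αs) ⟩
    (x - α) * 0#                     ≈⟨ zeroʳ _ ⟩
    0#                               ∎

  module _ (1≉0 : ¬ (1# ≈ 0#)) (integral : ∀ x y → x * y ≈ 0# → x ≈ 0# ⊎ y ≈ 0#) where

    eval-fromRoots≈0⇒∈ : ∀ {x} αs → eval (fromRoots αs) x ≈ 0# → Any (x ≈_) αs
    eval-fromRoots≈0⇒∈ {x} [] 1≈0 = contradiction (begin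
      1#           ≈⟨ solve 1 (λ x → :1 := :1 :+ x :* :0) refl x ⟩
      1# + x * 0#  ≈⟨ 1≈0 ⟩
      0#           ∎) 1≉0
    eval-fromRoots≈0⇒∈ {x} (α ∷ αs) root =
      case integral _ _ (trans (sym (eval-fromRoots-∷ α αs x)) root) of λ where
        (inj₁ x-α≈0) → here (begin
          x            ≈⟨ solve 2 (λ x α → x := (x :- α) :+ α) refl x α ⟩
          (x - α) + α  ≈⟨ +-congʳ x-α≈0 ⟩
          0# + α       ≈⟨ +-identityˡ α ⟩
          α            ∎)
        (inj₂ rest)  → there (eval-fromRoots≈0⇒∈ αs rest)

module RealAnalysis (lem : ExcludedMiddle 0ℓ) (R : CompleteOrderedField) where
  open Analysis lem R public
  open RingProperties (CommutativeRing.ring commutativeRing) public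
    using (-0#≈0#; -‿involutive)
  open Exp (CommutativeRing.commutativeSemiring commutativeRing) public
    using (_^_; ^-congˡ; ^-distrib-*)
  open Mult (CommutativeRing.semiring commutativeRing) public
    using (×1-homo-*)
  open TotalOrder totalOrder public using (poset; antisym; total; ≤-respˡ-≈; ≤-respʳ-≈)
    renaming (refl to ≤-refl; trans to ≤-trans; reflexive to ≤-reflexive)
  open ≤-Reasoning poset public hiding (step-≡)
  open Max totalOrder public using (x≤x⊔y; x≤y⊔x; ⊔-lub; ⊔-congˡ)
  open IntegerCoefficients commutativeRing public

  -- Ordered fields

  ≰⇒< : ∀ {x y} → ¬ (x ≤ y) → y < x
  ≰⇒< {x} {y} x≰y with total x y
  ... | inj₁ x≤y = contradiction x≤y x≰y
  ... | inj₂ y≤x = y≤x , λ y≈x → x≰y (≤-reflexive (sym y≈x))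

  ≤-stable : ∀ {x y} → ¬ (y < x) → x ≤ y
  ≤-stable y≮x = decidable-stable lem (y≮x ∘ ≰⇒<)

  <⇒≱ : ∀ {x y} → x < y → ¬ (y ≤ x)
  <⇒≱ (x≤y , x≉y) y≤x = x≉y (antisym x≤y y≤x)

  +-monoˡ-≤ : ∀ z {x y} → x ≤ y → x + z ≤ y + z
  +-monoˡ-≤ z {x} {y} x≤y = begin
    x + z  ≈⟨ +-comm x z ⟩
    z + x  ≤⟨ +-monoʳ-≤ z x≤y ⟩
    z + y  ≈⟨ +-comm z y ⟩
    y + z  ∎

  +-mono-≤ : ∀ {x y u v} → x ≤ y → u ≤ v → x + u ≤ y + v
  +-mono-≤ {y = y} {u} x≤y u≤v = ≤-trans (+-monoˡ-≤ u x≤y) (+-monoʳ-≤ y u≤v)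

  x≤y⇒0≤y-x : ∀ {x y} → x ≤ y → 0# ≤ y - x
  x≤y⇒0≤y-x {x} {y} x≤y = begin
    0#     ≈⟨ -‿inverseʳ x ⟨
    x - x  ≤⟨ +-monoˡ-≤ (- x) x≤y ⟩
    y - x  ∎

  -- Turns an algebraic certificate y = x + (nonnegative) into x ≤ y.
  ≤-by : ∀ {x y z} → 0# ≤ z → y ≈ x + z → x ≤ y
  ≤-by {x} {y} {z} 0≤z y≈x+z = begin
    x       ≈⟨ +-identityʳ x ⟨
    x + 0#  ≤⟨ +-monoʳ-≤ x 0≤z ⟩
    x + z   ≈⟨ y≈x+z ⟨
    y       ∎

  neg-mono-≤ : ∀ {x y} → x ≤ y → - y ≤ - x
  neg-mono-≤ {x} {y} x≤y = ≤-by (x≤y⇒0≤y-x x≤y)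
    (solve 2 (λ x y → :- x := :- y :+ (y :- x)) refl x y)

  x≤0⇒0≤-x : ∀ {x} → x ≤ 0# → 0# ≤ - x
  x≤0⇒0≤-x x≤0 = ≤-respˡ-≈ -0#≈0# (neg-mono-≤ x≤0)

  0≤x² : ∀ x → 0# ≤ x * x
  0≤x² x with total 0# x
  ... | inj₁ 0≤x = *-nonNeg 0≤x 0≤x
  ... | inj₂ x≤0 = ≤-respʳ-≈ (solve 1 (λ x → :- x :* :- x := x :* x) refl x)
                     (*-nonNeg (x≤0⇒0≤-x x≤0) (x≤0⇒0≤-x x≤0))

  +-nonNeg : ∀ {x y} → 0# ≤ x → 0# ≤ y → 0# ≤ x + y
  +-nonNeg 0≤x 0≤y = ≤-respˡ-≈ (+-identityʳ 0#) (+-mono-≤ 0≤x 0≤y)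

  0≤1 : 0# ≤ 1#
  0≤1 = ≤-respʳ-≈ (*-identityʳ 1#) (0≤x² 1#)

  0<1 : 0# < 1#
  0<1 = 0≤1 , 0≉1

  *-monoˡ-≤ : ∀ {x y z} → 0# ≤ z → x ≤ y → x * z ≤ y * z
  *-monoˡ-≤ {x} {y} {z} 0≤z x≤y = ≤-by (*-nonNeg (x≤y⇒0≤y-x x≤y) 0≤z)
    (solve 3 (λ x y z → y :* z := x :* z :+ (y :- x) :* z) refl x y z)

  *-monoʳ-≤ : ∀ {x y z} → 0# ≤ z → x ≤ y → z * x ≤ z * y
  *-monoʳ-≤ {x} {y} {z} 0≤z x≤y = ≤-by (*-nonNeg 0≤z (x≤y⇒0≤y-x x≤y))
    (solve 3 (λ x y z → z :* y := z :* x :+ z :* (y :- x)) refl x y z)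

  *-mono-≤ : ∀ {x y u v} → 0# ≤ u → 0# ≤ y → x ≤ y → u ≤ v → x * u ≤ y * v
  *-mono-≤ 0≤u 0≤y x≤y u≤v = ≤-trans (*-monoˡ-≤ 0≤u x≤y) (*-monoʳ-≤ 0≤y u≤v)

  _⁻¹[_] : ∀ x → ¬ (x ≈ 0#) → ℝ
  x ⁻¹[ x≉0 ] = proj₁ (invertible x x≉0)

  ⁻¹-inverseˡ : ∀ x (x≉0 : ¬ (x ≈ 0#)) → x ⁻¹[ x≉0 ] * x ≈ 1#
  ⁻¹-inverseˡ x x≉0 = proj₁ (proj₂ (invertible x x≉0))

  x*y≈0⇒y≈0 : ∀ {x y} → ¬ (x ≈ 0#) → x * y ≈ 0# → y ≈ 0#
  x*y≈0⇒y≈0 {x} {y} x≉0 xy≈0 = begin-equality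
    y                     ≈⟨ *-identityˡ y ⟨
    1# * y                ≈⟨ *-congʳ (⁻¹-inverseˡ x x≉0) ⟨
    x ⁻¹[ x≉0 ] * x * y   ≈⟨ *-assoc _ x y ⟩
    x ⁻¹[ x≉0 ] * (x * y) ≈⟨ *-congˡ xy≈0 ⟩
    x ⁻¹[ x≉0 ] * 0#      ≈⟨ zeroʳ _ ⟩
    0#                    ∎

  no-zero-divisors : ∀ {x y} → x * y ≈ 0# → x ≈ 0# ⊎ y ≈ 0#
  no-zero-divisors {x} xy≈0 with lem {P = x ≈ 0#}
  ... | yes x≈0 = inj₁ x≈0
  ... | no  x≉0 = inj₂ (x*y≈0⇒y≈0 x≉0 xy≈0)

  *-pos : ∀ {x y} → 0# < x → 0# < y → 0# < x * y
  *-pos (0≤x , 0≉x) (0≤y , 0≉y) =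
    *-nonNeg 0≤x 0≤y , λ 0≈xy → 0≉y (sym (x*y≈0⇒y≈0 (0≉x ∘ sym) (sym 0≈xy)))

  x<y⇒0<y-x : ∀ {x y} → x < y → 0# < y - x
  x<y⇒0<y-x {x} {y} (x≤y , x≉y) = x≤y⇒0≤y-x x≤y , λ 0≈y-x → x≉y (begin-equality
    x            ≈⟨ +-identityˡ x ⟨
    0# + x       ≈⟨ +-congʳ 0≈y-x ⟩
    (y - x) + x  ≈⟨ solve 2 (λ x y → (y :- x) :+ x := y) refl x y ⟩
    y            ∎)

  <-by : ∀ {x y z} → 0# < z → y ≈ x + z → x < y
  <-by {x} {y} {z} (0≤z , 0≉z) y≈x+z = ≤-by 0≤z y≈x+z , λ x≈y → 0≉z (begin-equality
    0#           ≈⟨ -‿inverseʳ x ⟨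
    x - x        ≈⟨ +-congʳ (trans x≈y y≈x+z) ⟩
    (x + z) - x  ≈⟨ solve 2 (λ x z → (x :+ z) :- x := z) refl x z ⟩
    z            ∎)

  *-cancelˡ-≤ : ∀ {x y z} → 0# < z → z * x ≤ z * y → x ≤ y
  *-cancelˡ-≤ {x} {y} {z} 0<z zx≤zy = ≤-stable λ y<x →
    <⇒≱ (<-by (*-pos 0<z (x<y⇒0<y-x y<x))
          (solve 3 (λ x y z → z :* x := z :* y :+ z :* (x :- y)) refl x y z))
        zx≤zy

  inverse-pos : ∀ {x y} → 0# ≤ x → y * x ≈ 1# → 0# < y
  inverse-pos {x} {y} 0≤x yx≈1 = ≰⇒< λ y≤0 → <⇒≱ 0<1 (begin
    1#     ≈⟨ yx≈1 ⟨
    y * x  ≤⟨ *-monoˡ-≤ 0≤x y≤0 ⟩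
    0# * x ≈⟨ zeroˡ x ⟩
    0#     ∎)

  0≤x^n : ∀ {x} → 0# ≤ x → ∀ n → 0# ≤ x ^ n
  0≤x^n 0≤x zero    = 0≤1
  0≤x^n 0≤x (suc n) = *-nonNeg 0≤x (0≤x^n 0≤x n)

  0<x^n : ∀ {x} → 0# < x → ∀ n → 0# < x ^ n
  0<x^n 0<x zero    = 0<1
  0<x^n 0<x (suc n) = *-pos 0<x (0<x^n 0<x n)

  ^-monoˡ-≤ : ∀ {x y} → 0# ≤ x → x ≤ y → ∀ n → x ^ n ≤ y ^ n
  ^-monoˡ-≤ 0≤x x≤y zero    = ≤-refl
  ^-monoˡ-≤ 0≤x x≤y (suc n) =
    *-mono-≤ (0≤x^n 0≤x n) (≤-trans 0≤x x≤y) x≤y (^-monoˡ-≤ 0≤x x≤y n)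

  ^-cancelˡ-≤ : ∀ {x y} n → 0# ≤ y → x ^ suc n ≤ y ^ suc n → x ≤ y
  ^-cancelˡ-≤ {x} {y} n 0≤y x^n≤y^n = ≤-stable λ y<x →
    <⇒≱ (begin-strict
      y * y ^ n  ≤⟨ *-monoʳ-≤ 0≤y (^-monoˡ-≤ 0≤y (proj₁ y<x) n) ⟩
      y * x ^ n  <⟨ <-by (*-pos (x<y⇒0<y-x y<x) (0<x^n (0≤y<x⇒0<x y<x) n))
                      (solve 3 (λ x y z → x :* z := y :* z :+ (x :- y) :* z) refl x y (x ^ n)) ⟩
      x * x ^ n  ∎) x^n≤y^n
    where
    0≤y<x⇒0<x : y < x → 0# < x
    0≤y<x⇒0<x y<x = begin-strict
      0# ≤⟨ 0≤y ⟩
      y  <⟨ y<x ⟩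
      x  ∎

  x²≤y²⇒x≤y : ∀ {x y} → 0# ≤ y → x * x ≤ y * y → x ≤ y
  x²≤y²⇒x≤y {x} {y} 0≤y x²≤y² = ^-cancelˡ-≤ 1 0≤y (begin
    x * (x * 1#)  ≈⟨ *-congˡ (*-identityʳ x) ⟩
    x * x         ≤⟨ x²≤y² ⟩
    y * y         ≈⟨ *-congˡ (*-identityʳ y) ⟨
    y * (y * 1#)  ∎)

  the-satisfies : ∀ (P : ℝ → Set) → ∃ P → P (the P)
  the-satisfies P ∃P with lem {P = ∃ P}
  ... | yes (_ , Px) = Px
  ... | no  ¬∃P      = contradiction ∃P ¬∃P

  /-spec : ∀ x {y} → ¬ (y ≈ 0#) → (x / y) * y ≈ x
  /-spec x {y} y≉0 = the-satisfies (λ z → z * y ≈ x) (x * y ⁻¹[ y≉0 ] , (begin-equality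
    x * y ⁻¹[ y≉0 ] * y    ≈⟨ *-assoc x _ y ⟩
    x * (y ⁻¹[ y≉0 ] * y)  ≈⟨ *-congˡ (⁻¹-inverseˡ y y≉0) ⟩
    x * 1#                 ≈⟨ *-identityʳ x ⟩
    x                      ∎))

  -- Roots of nonnegative reals

  1≤⇒x≤x^1+n : ∀ {x} → 1# ≤ x → ∀ n → x ≤ x ^ suc n
  1≤⇒x≤x^1+n {x} 1≤x zero    = ≤-reflexive (sym (*-identityʳ x))
  1≤⇒x≤x^1+n {x} 1≤x (suc n) = begin
    x                ≤⟨ 1≤⇒x≤x^1+n 1≤x n ⟩
    x ^ suc n        ≈⟨ *-identityˡ _ ⟨
    1# * x ^ suc n   ≤⟨ *-monoˡ-≤ (0≤x^n (≤-trans 0≤1 1≤x) (suc n)) 1≤x ⟩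
    x * x ^ suc n    ∎

  -- Convexity: between s and s + 1 the power lies below its chord. It serves as a quantitative form
  -- of continuity, since raising s by ε raises the power by at most ε times a slope independent of
  -- ε.
  ^-convex : ∀ {s ε} → 0# ≤ s → 0# ≤ ε → ε ≤ 1# → ∀ n →
             (s + ε) ^ n ≤ s ^ n + ε * ((s + 1#) ^ n - s ^ n)
  ^-convex {s} {ε} 0≤s 0≤ε ε≤1 zero = ≤-reflexive
    (solve 1 (λ ε → :1 := :1 :+ ε :* (:1 :- :1)) refl ε)
  ^-convex {s} {ε} 0≤s 0≤ε ε≤1 (suc n) = begin
    (s + ε) * (s + ε) ^ n
      ≤⟨ *-monoʳ-≤ (+-nonNeg 0≤s 0≤ε) (^-convex 0≤s 0≤ε ε≤1 n) ⟩
    (s + ε) * (A + ε * (B - A))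
      ≤⟨ ≤-by (*-nonNeg (*-nonNeg 0≤ε (x≤y⇒0≤y-x ε≤1)) (x≤y⇒0≤y-x A≤B))
          (solve 4 (λ s ε A B →
            s :* A :+ ε :* ((s :+ :1) :* B :- s :* A) :=
            (s :+ ε) :* (A :+ ε :* (B :- A)) :+ (ε :* (:1 :- ε)) :* (B :- A))
            refl s ε A B) ⟩
    s * A + ε * ((s + 1#) * B - s * A)
      ∎
    where
    A = s ^ n
    B = (s + 1#) ^ n
    A≤B : A ≤ B
    A≤B = ^-monoˡ-≤ 0≤s (≤-by 0≤1 refl) n

  -- The witness is the smaller of b and g / (1 + K); the summand 1 keeps the divisor positive even
  -- when K is 0.
  small-multiplier : ∀ {b g K} → 0# < b → 0# < g → 0# ≤ K →
                     ∃[ ε ] 0# < ε × ε ≤ b × ε * K ≤ g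
  small-multiplier {b} {g} {K} 0<b 0<g 0≤K with lem {P = 1# + K ≈ 0#}
  ... | yes 1+K≈0 = contradiction (≤-reflexive 1+K≈0) (<⇒≱ 0<1+K)
    where
    0<1+K : 0# < 1# + K
    0<1+K = begin-strict
      0#       <⟨ 0<1 ⟩
      1#       ≤⟨ ≤-by 0≤K refl ⟩
      1# + K   ∎
  ... | no 1+K≉0 = case total b c of λ where
      (inj₁ b≤c) → b , 0<b , ≤-refl , ≤-trans (*-monoˡ-≤ 0≤K b≤c) cK≤g
      (inj₂ c≤b) → c , 0<c , c≤b , cK≤g
    where
    c = g * (1# + K) ⁻¹[ 1+K≉0 ]
    0<c : 0# < c
    0<c = *-pos 0<g (inverse-pos (+-nonNeg 0≤1 0≤K) (⁻¹-inverseˡ (1# + K) 1+K≉0))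
    cK≤g : c * K ≤ g
    cK≤g = begin
      c * K         ≤⟨ *-monoʳ-≤ (proj₁ 0<c) (≤-by 0≤1 (+-comm 1# K)) ⟩
      c * (1# + K)  ≈⟨ *-assoc g _ _ ⟩
      g * ((1# + K) ⁻¹[ 1+K≉0 ] * (1# + K))  ≈⟨ *-congˡ (⁻¹-inverseˡ (1# + K) 1+K≉0) ⟩
      g * 1#        ≈⟨ *-identityʳ g ⟩
      g             ∎

  private
    module Root {a : ℝ} (0≤a : 0# ≤ a) (k : ℕ) where
      n = suc k

      -- The n-th root of a is constructed as the supremum `s` of this set.
      Below : ℝ → Set
      Below x = 0# ≤ x × x ^ n ≤ a

      0∈Below : Below 0#
      0∈Below = ≤-refl , ≤-respˡ-≈ (sym (zeroˡ _)) 0≤a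

      Below-bounded : IsUpperBound Below (1# + a)
      Below-bounded x (_ , x^n≤a) = ^-cancelˡ-≤ k (+-nonNeg 0≤1 0≤a) (begin
        x ^ n         ≤⟨ x^n≤a ⟩
        a             ≤⟨ ≤-by 0≤1 (+-comm 1# a) ⟩
        1# + a        ≤⟨ 1≤⇒x≤x^1+n (≤-by 0≤a refl) k ⟩
        (1# + a) ^ n  ∎)

      s : ℝ
      s = proj₁ (complete Below (0# , 0∈Below) (1# + a , Below-bounded))

      s-upper : IsUpperBound Below s
      s-upper = proj₁ (proj₂ (complete Below (0# , 0∈Below) (1# + a , Below-bounded)))

      s-least : ∀ c → IsUpperBound Below c → s ≤ c
      s-least = proj₂ (proj₂ (complete Below (0# , 0∈Below) (1# + a , Below-bounded)))

      0≤s : 0# ≤ s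
      0≤s = s-upper 0# 0∈Below

      slope-nonNeg : ∀ {y} → 0# ≤ y → 0# ≤ (y + 1#) ^ n - y ^ n
      slope-nonNeg 0≤y = x≤y⇒0≤y-x (^-monoˡ-≤ 0≤y (≤-by 0≤1 refl) n)

      -- If the power fell short of a, a step ε small against the gap and the chord slope would keep
      -- s + ε in `Below`, above its supremum.
      a≤s^n : a ≤ s ^ n
      a≤s^n = ≤-stable λ s^n<a →
        let ε , 0<ε , ε≤1 , εK≤gap =
              small-multiplier 0<1 (x<y⇒0<y-x s^n<a) (slope-nonNeg 0≤s)
            s+ε∈Below : Below (s + ε)
            s+ε∈Below = +-nonNeg 0≤s (proj₁ 0<ε) , (begin
              (s + ε) ^ n                            ≤⟨ ^-convex 0≤s (proj₁ 0<ε) ε≤1 n ⟩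
              s ^ n + ε * ((s + 1#) ^ n - s ^ n)     ≤⟨ +-monoʳ-≤ _ εK≤gap ⟩
              s ^ n + (a - s ^ n)                    ≈⟨ solve 2 (λ u a → u :+ (a :- u) := a) refl (s ^ n) a ⟩
              a                                      ∎)
        in <⇒≱ (<-by 0<ε refl) (s-upper (s + ε) s+ε∈Below)

      0<s : a < s ^ n → 0# < s
      0<s a<s^n = ≰⇒< λ s≤0 → <⇒≱ a<s^n (begin
        s * s ^ k   ≤⟨ *-monoˡ-≤ (0≤x^n 0≤s k) s≤0 ⟩
        0# * s ^ k  ≈⟨ zeroˡ _ ⟩
        0#          ≤⟨ 0≤a ⟩
        a           ∎)

      -- If the power exceeded a, some s - ε would still have its power at least a, hence be an
      -- upper bound of `Below` smaller than the least one.
      s^n≤a : s ^ n ≤ a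
      s^n≤a = ≤-stable λ a<s^n →
        let K = (s + 1#) ^ n
            -- Taking the multiplier 1 yields a positive b below both 1 and s: the first bound is
            -- what `^-convex` asks of ε, the second keeps s - ε nonnegative.
            b , 0<b , b≤1 , b1≤s = small-multiplier 0<1 (0<s a<s^n) 0≤1
            ε , 0<ε , ε≤b , εK≤gap = small-multiplier 0<b (x<y⇒0<y-x a<s^n)
                                       (0≤x^n (+-nonNeg 0≤s 0≤1) n)
            y = s - ε
            0≤y = x≤y⇒0≤y-x (≤-trans ε≤b (≤-respˡ-≈ (*-identityʳ b) b1≤s))
            y≤s = ≤-by (proj₁ 0<ε) (solve 2 (λ s ε → s := (s :- ε) :+ ε) refl s ε)
            s^n≤ = begin
              s ^ n                               ≈⟨ ^-congˡ n (solve 2 (λ s ε → s := (s :- ε) :+ ε) refl s ε) ⟩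
              (y + ε) ^ n                         ≤⟨ ^-convex 0≤y (proj₁ 0<ε) (≤-trans ε≤b b≤1) n ⟩
              -- The chord slope at y depends on ε. It is replaced by `K`, which was fixed before ε
              -- was chosen and dominates the slope because y ≤ s.
              y ^ n + ε * ((y + 1#) ^ n - y ^ n)  ≤⟨ +-monoʳ-≤ _ (*-monoʳ-≤ (proj₁ 0<ε)
                (≤-by (0≤x^n 0≤y n) (solve 2 (λ u v → u := (u :- v) :+ v) refl _ _))) ⟩
              y ^ n + ε * (y + 1#) ^ n            ≤⟨ +-monoʳ-≤ _ (*-monoʳ-≤ (proj₁ 0<ε)
                (^-monoˡ-≤ (+-nonNeg 0≤y 0≤1) (+-monoˡ-≤ 1# y≤s) n)) ⟩
              y ^ n + ε * K                       ≤⟨ +-monoʳ-≤ _ εK≤gap ⟩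
              y ^ n + (s ^ n - a)                 ∎
            a≤y^n = ≤-by (x≤y⇒0≤y-x s^n≤)
              (solve 3 (λ a u v → v := a :+ ((v :+ (u :- a)) :- u)) refl a (s ^ n) (y ^ n))
            s≤y = s-least y λ x x∈Below →
                    ^-cancelˡ-≤ k 0≤y (≤-trans (proj₂ x∈Below) a≤y^n)
        in <⇒≱ (<-by 0<ε (solve 2 (λ s ε → s := (s :- ε) :+ ε) refl s ε)) s≤y

  ^1/-spec : ∀ {a} → 0# ≤ a → ∀ k → 0# ≤ a ^1/ suc k × (a ^1/ suc k) ^ suc k ≈ a
  ^1/-spec {a} 0≤a k = the-satisfies (λ x → 0# ≤ x × x ^ suc k ≈ a)
    (s , 0≤s , antisym s^n≤a a≤s^n)
    where open Root 0≤a k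

  √-nonNeg : ∀ {a} → 0# ≤ a → 0# ≤ √ a
  √-nonNeg 0≤a = proj₁ (^1/-spec 0≤a 1)

  √-square : ∀ {a} → 0# ≤ a → √ a * √ a ≈ a
  √-square 0≤a = trans (*-congˡ (sym (*-identityʳ _))) (proj₂ (^1/-spec 0≤a 1))

  -- The exponential series and n! ≥ (n + 1)ⁿ / eⁿ

  0≤fromℕ : ∀ n → 0# ≤ fromℕ n
  0≤fromℕ zero    = ≤-refl
  0≤fromℕ (suc n) = +-nonNeg 0≤1 (0≤fromℕ n)

  0<fromℕ : ∀ n .{{_ : ℕ.NonZero n}} → 0# < fromℕ n
  0<fromℕ (suc n) = begin-strict
    0#            <⟨ 0<1 ⟩
    1#            ≤⟨ ≤-by (0≤fromℕ n) refl ⟩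
    fromℕ (suc n) ∎

  fromℕ≉0 : ∀ n .{{_ : ℕ.NonZero n}} → ¬ (fromℕ n ≈ 0#)
  fromℕ≉0 n = proj₂ (0<fromℕ n) ∘ sym

  1/_! : ℕ → ℝ
  1/ n ! = 1# / fromℕ (n ℕ.!)

  1/n!-inverse : ∀ n → 1/ n ! * fromℕ (n ℕ.!) ≈ 1#
  1/n!-inverse n = /-spec 1# (fromℕ≉0 (n ℕ.!))
    where instance n!≢0 = n ℕ.!≢0

  1/n!-nonNeg : ∀ n → 0# ≤ 1/ n !
  1/n!-nonNeg n = proj₁ (inverse-pos (0≤fromℕ (n ℕ.!)) (1/n!-inverse n))

  1/n!-suc : ∀ n → 1/ n ! ≈ fromℕ (suc n) * 1/ suc n !
  1/n!-suc n = begin-equality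
    u                    ≈⟨ *-identityʳ u ⟨
    u * 1#               ≈⟨ *-congˡ (1/n!-inverse (suc n)) ⟨
    u * (v * fromℕ (suc n ℕ.!))
      ≈⟨ *-congˡ (*-congˡ (×1-homo-* (suc n) (n ℕ.!))) ⟩
    u * (v * (fromℕ (suc n) * fromℕ (n ℕ.!)))
      ≈⟨ solve 4 (λ u v p q → u :* (v :* (p :* q)) := (u :* q) :* (p :* v)) refl u v _ _ ⟩
    (u * fromℕ (n ℕ.!)) * (fromℕ (suc n) * v)
      ≈⟨ *-congʳ (1/n!-inverse n) ⟩
    1# * (fromℕ (suc n) * v)
      ≈⟨ *-identityˡ _ ⟩
    fromℕ (suc n) * v    ∎
    where
    u = 1/ n !
    v = 1/ suc n !

  expSum-suc-≤ : ∀ n → expSum n ≤ expSum (suc n)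
  expSum-suc-≤ n = ≤-by (1/n!-nonNeg (suc n)) refl

  expSum-mono-≤ : ∀ {m n} → m ℕ.≤′ n → expSum m ≤ expSum n
  expSum-mono-≤ (ℕ.≤′-reflexive ≡.refl) = ≤-refl
  expSum-mono-≤ {n = suc n} (ℕ.≤′-step m≤n) = ≤-trans (expSum-mono-≤ m≤n) (expSum-suc-≤ n)

  -- Strengthened by the last summand so that the induction goes through.
  expSum-bound : ∀ n → expSum (suc n) + 1/ suc n ! ≤ expSum 1 + 1/ 1 !
  expSum-bound zero    = ≤-refl
  expSum-bound (suc n) = begin
    (expSum (suc n) + v) + v
      ≤⟨ ≤-by (*-nonNeg (0≤fromℕ n) (1/n!-nonNeg (2 ℕ.+ n)))
          (solve 3 (λ p m v → p :+ (:1 :+ (:1 :+ m)) :* v := (p :+ v) :+ v :+ m :* v) refl _ _ v) ⟩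
    expSum (suc n) + fromℕ (2 ℕ.+ n) * v
      ≈⟨ +-congˡ (1/n!-suc (suc n)) ⟨
    expSum (suc n) + 1/ suc n !
      ≤⟨ expSum-bound n ⟩
    expSum 1 + 1/ 1 !
      ∎
    where v = 1/ 2 ℕ.+ n !

  -- The limit is the supremum l of the range: if no index brought the sequence within η of l, then
  -- l - η would already be an upper bound.
  monotone-bounded-converges : ∀ (u : ℕ → ℝ) → (∀ {m n} → m ℕ.≤ n → u m ≤ u n) →
                               ∀ b → (∀ n → u n ≤ b) → ∃[ l ] u ⟶ l
  monotone-bounded-converges u u-mono b u≤b =
      let l , l-upper , l-least = complete Range (u 0 , 0 , refl) (b , below-b)
      in l , λ η 0<η → decidable-stable lem λ no-N →
           <⇒≱ (<-by 0<η (solve 2 (λ l η → l := (l :- η) :+ η) refl l η))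
             (l-least (l - η) λ x (N , x≈uN) → ≤-stable λ l-η<x → no-N (N , λ n N≤n →
               let l-η<un = begin-strict
                     l - η  <⟨ l-η<x ⟩
                     x      ≈⟨ x≈uN ⟩
                     u N    ≤⟨ u-mono N≤n ⟩
                     u n    ∎
                   un≤l = l-upper (u n) (n , refl)
               in ⊔-<-lub
                    (begin-strict
                      u n - l  ≤⟨ +-monoˡ-≤ (- l) un≤l ⟩
                      l - l    ≈⟨ -‿inverseʳ l ⟩
                      0#       <⟨ 0<η ⟩
                      η        ∎)
                    (<-by (x<y⇒0<y-x l-η<un)
                      (solve 3 (λ u l η → η := :- (u :- l) :+ (u :- (l :- η))) refl (u n) l η))))
    where
    Range : ℝ → Set
    Range x = ∃[ n ] x ≈ u n
    below-b : IsUpperBound Range b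
    below-b x (n , x≈un) = ≤-respˡ-≈ (sym x≈un) (u≤b n)
    ⊔-<-lub : ∀ {x y z} → x < z → y < z → x ⊔ y < z
    ⊔-<-lub {x} {y} x<z y<z with total y x
    ... | inj₁ _ = x<z
    ... | inj₂ _ = y<z

  monotone-≤-limit : ∀ (u : ℕ → ℝ) → (∀ {m n} → m ℕ.≤ n → u m ≤ u n) →
                     ∀ {l} → u ⟶ l → ∀ n → u n ≤ l
  monotone-≤-limit u u-mono {l} u⟶l m = ≤-stable λ l<um →
    let N , close = u⟶l (u m - l) (x<y⇒0<y-x l<um)
        k = m ℕ.⊔ N
    in <⇒≱ (close k (ℕ.m≤n⊔m m N)) (begin
         u m - l        ≤⟨ +-monoˡ-≤ (- l) (u-mono (ℕ.m≤m⊔n m N)) ⟩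
         u k - l        ≤⟨ x≤x⊔y _ _ ⟩
         abs (u k - l)  ∎)

  expSum⟶e : expSum ⟶ e
  expSum⟶e = the-satisfies (λ x → expSum ⟶ x)
    (monotone-bounded-converges expSum (expSum-mono-≤ ∘ ℕ.≤⇒≤′) (expSum 1 + 1/ 1 !)
      λ n → begin
        expSum n                     ≤⟨ expSum-suc-≤ n ⟩
        expSum (suc n)               ≤⟨ ≤-by (1/n!-nonNeg (suc n)) refl ⟩
        expSum (suc n) + 1/ suc n !  ≤⟨ expSum-bound n ⟩
        expSum 1 + 1/ 1 !            ∎)

  expSum≤e : ∀ n → expSum n ≤ e
  expSum≤e = monotone-≤-limit expSum (expSum-mono-≤ ∘ ℕ.≤⇒≤′) expSum⟶e

  0≤e : 0# ≤ e
  0≤e = ≤-trans 0≤1 (expSum≤e 0)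

  -- The Taylor polynomial of exp, as the sum of yʲ / j! over j < n. The bound on j is strict, so
  -- `expTerms (suc n) 1#` corresponds to `expSum n`.
  expTerms : ℕ → ℝ → ℝ
  expTerms zero    y = 0#
  expTerms (suc n) y = expTerms n y + y ^ n * 1/ n !

  -- The tangent to the power at y lies below its graph. In `expTerms-step` the factor n + 1 of the
  -- slope turns 1 / (n + 1)! into 1 / n!, which matches a term of the shorter sum.
  bernoulli : ∀ {x y} → 0# ≤ x → 0# ≤ y → ∀ n →
              y ^ suc n + x * (fromℕ (suc n) * y ^ n) ≤ (y + x) ^ suc n
  bernoulli {x} {y} 0≤x 0≤y zero = ≤-reflexive
    (solve 2 (λ x y → y :* :1 :+ x :* ((:1 :+ :0) :* :1) := (y :+ x) :* :1) refl x y)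
  bernoulli {x} {y} 0≤x 0≤y (suc n) = begin
    y * (y * z) + x * ((1# + (1# + m)) * (y * z))
      ≤⟨ ≤-by (*-nonNeg (*-nonNeg 0≤x 0≤x) (*-nonNeg (0≤fromℕ (suc n)) (0≤x^n 0≤y n)))
          (solve 4 (λ x y z m →
            (y :+ x) :* (y :* z :+ x :* ((:1 :+ m) :* z)) :=
            (y :* (y :* z) :+ x :* ((:1 :+ (:1 :+ m)) :* (y :* z))) :+ (x :* x) :* ((:1 :+ m) :* z))
            refl x y z m) ⟩
    (y + x) * (y * z + x * ((1# + m) * z))
      ≤⟨ *-monoʳ-≤ (+-nonNeg 0≤y 0≤x) (bernoulli 0≤x 0≤y n) ⟩
    (y + x) * (y + x) ^ suc n
      ∎
    where
    z = y ^ n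
    m = fromℕ n

  -- The termwise comparison behind (1 + x) exp y ≤ exp (y + x), one degree higher.
  expTerms-step : ∀ {x y} → 0# ≤ x → 0# ≤ y → ∀ n →
                  expTerms (suc n) y + x * expTerms n y ≤ expTerms (suc n) (y + x)
  expTerms-step {x} {y} 0≤x 0≤y zero = ≤-reflexive
    (solve 2 (λ x c → (:0 :+ :1 :* c) :+ x :* :0 := :0 :+ :1 :* c) refl x (1/ 0 !))
  expTerms-step {x} {y} 0≤x 0≤y (suc n) = begin
    (expTerms (suc n) y + y ^ suc n * v) + x * (expTerms n y + y ^ n * 1/ n !)
      ≈⟨ +-congˡ (*-congˡ (+-congˡ (*-congˡ (1/n!-suc n)))) ⟩
    (expTerms (suc n) y + y ^ suc n * v) + x * (expTerms n y + y ^ n * (fromℕ (suc n) * v))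
      ≈⟨ solve 7 (λ P Q x w z m v → (P :+ w :* v) :+ x :* (Q :+ z :* (m :* v)) :=
           (P :+ x :* Q) :+ (w :+ x :* (m :* z)) :* v) refl _ _ x _ _ _ v ⟩
    (expTerms (suc n) y + x * expTerms n y) + (y ^ suc n + x * (fromℕ (suc n) * y ^ n)) * v
      ≤⟨ +-mono-≤ (expTerms-step 0≤x 0≤y n)
           (*-monoˡ-≤ (1/n!-nonNeg (suc n)) (bernoulli 0≤x 0≤y n)) ⟩
    expTerms (suc n) (y + x) + (y + x) ^ suc n * v
      ∎
    where v = 1/ suc n !

  expTerms-cong : ∀ n {x y} → x ≈ y → expTerms n x ≈ expTerms n y
  expTerms-cong zero    x≈y = refl
  expTerms-cong (suc n) x≈y = +-cong (expTerms-cong n x≈y) (*-congʳ (^-congˡ n x≈y))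

  expTerms-mono : ∀ {y} → 0# ≤ y → ∀ n → expTerms n y ≤ expTerms (suc n) y
  expTerms-mono 0≤y n = ≤-by (*-nonNeg (0≤x^n 0≤y n) (1/n!-nonNeg n)) refl

  -- A truncated form of (1 + x)ⁿ ≤ exp (n x): each factor 1 + x moves the argument forward by x at
  -- the price of one more Taylor term. With n x = 1 the right side is a partial sum of the series
  -- for `e`.
  [1+x]^n≤expTerms : ∀ {x} → 0# ≤ x → ∀ n →
                     (1# + x) ^ n ≤ expTerms (suc n) (fromℕ n * x)
  [1+x]^n≤expTerms {x} 0≤x zero = ≤-reflexive (begin-equality
    1#                 ≈⟨ 1/n!-inverse 0 ⟨
    1/ 0 ! * (1# + 0#) ≈⟨ solve 1 (λ c → c :* (:1 :+ :0) := :0 :+ :1 :* c) refl _ ⟩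
    0# + 1# * 1/ 0 !   ∎)
  [1+x]^n≤expTerms {x} 0≤x (suc n) = begin
    (1# + x) * (1# + x) ^ n
      ≤⟨ *-monoʳ-≤ (+-nonNeg 0≤1 0≤x) ([1+x]^n≤expTerms 0≤x n) ⟩
    (1# + x) * expTerms (suc n) y
      ≈⟨ solve 2 (λ x P → (:1 :+ x) :* P := P :+ x :* P) refl x _ ⟩
    expTerms (suc n) y + x * expTerms (suc n) y
      ≤⟨ +-monoˡ-≤ _ (expTerms-mono 0≤y (suc n)) ⟩
    expTerms (2 ℕ.+ n) y + x * expTerms (suc n) y
      ≤⟨ expTerms-step 0≤x 0≤y (suc n) ⟩
    expTerms (2 ℕ.+ n) (y + x)
      ≈⟨ expTerms-cong (2 ℕ.+ n) (solve 2 (λ m x → m :* x :+ x := (:1 :+ m) :* x) refl (fromℕ n) x) ⟩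
    expTerms (2 ℕ.+ n) (fromℕ (suc n) * x)
      ∎
    where
    y = fromℕ n * x
    0≤y = *-nonNeg (0≤fromℕ n) 0≤x

  expTerms-1 : ∀ n → expTerms (suc n) 1# ≈ expSum n
  expTerms-1 zero = begin-equality
    0# + 1# * 1/ 0 !    ≈⟨ solve 1 (λ c → :0 :+ :1 :* c := c :* (:1 :+ :0)) refl _ ⟩
    1/ 0 ! * (1# + 0#)  ≈⟨ 1/n!-inverse 0 ⟩
    1#                  ∎
  expTerms-1 (suc n) = +-cong (expTerms-1 n) (trans (*-congʳ (1^n≈1 (suc n))) (*-identityˡ _))
    where
    1^n≈1 : ∀ n → 1# ^ n ≈ 1#
    1^n≈1 zero    = refl
    1^n≈1 (suc n) = trans (*-identityˡ _) (1^n≈1 n)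

  -- (1 + 1/n)ⁿ ≤ e with denominators cleared.
  [1+n]^n≤n^n*e : ∀ n → fromℕ (suc n) ^ n ≤ fromℕ n ^ n * e
  -- Here `fromℕ 0 ^ 0` is 1, so the claim is 1 ≤ e.
  [1+n]^n≤n^n*e zero = ≤-respʳ-≈ (sym (*-identityˡ e)) (expSum≤e 0)
  [1+n]^n≤n^n*e n@(suc _) = begin
    (1# + k) ^ n             ≈⟨ ^-congˡ n (+-congʳ kx≈1) ⟨
    (k * x + k) ^ n          ≈⟨ ^-congˡ n (solve 2 (λ k x → k :* x :+ k := k :* (:1 :+ x)) refl k x) ⟩
    (k * (1# + x)) ^ n       ≈⟨ ^-distrib-* k (1# + x) n ⟩
    k ^ n * (1# + x) ^ n     ≤⟨ *-monoʳ-≤ (0≤x^n (0≤fromℕ n) n) (begin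
      (1# + x) ^ n              ≤⟨ [1+x]^n≤expTerms 0≤x n ⟩
      expTerms (suc n) (k * x)  ≈⟨ expTerms-cong (suc n) kx≈1 ⟩
      expTerms (suc n) 1#       ≈⟨ expTerms-1 n ⟩
      expSum n                  ≤⟨ expSum≤e n ⟩
      e                         ∎) ⟩
    k ^ n * e                ∎
    where
    k = fromℕ n
    x = k ⁻¹[ fromℕ≉0 n ]
    kx≈1 : k * x ≈ 1#
    kx≈1 = trans (*-comm k x) (⁻¹-inverseˡ k (fromℕ≉0 n))
    0≤x : 0# ≤ x
    0≤x = proj₁ (inverse-pos (0≤fromℕ n) (⁻¹-inverseˡ k (fromℕ≉0 n)))

  -- Telescoping: (n + 1)ⁿ / n! is the product of (1 + 1/k)ᵏ over 1 ≤ k ≤ n, and each factor is at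
  -- most `e`.
  [1+n]^n≤n!*e^n : ∀ n → fromℕ (suc n) ^ n ≤ fromℕ (n ℕ.!) * e ^ n
  [1+n]^n≤n!*e^n zero    = ≤-reflexive (solve 0 (:1 := (:1 :+ :0) :* :1) refl)
  [1+n]^n≤n!*e^n (suc n) = begin
    fromℕ (2 ℕ.+ n) ^ suc n
      ≤⟨ [1+n]^n≤n^n*e (suc n) ⟩
    (fromℕ (suc n) * fromℕ (suc n) ^ n) * e
      ≤⟨ *-monoˡ-≤ 0≤e (*-monoʳ-≤ (0≤fromℕ (suc n)) ([1+n]^n≤n!*e^n n)) ⟩
    (fromℕ (suc n) * (fromℕ (n ℕ.!) * e ^ n)) * e
      ≈⟨ solve 4 (λ k f z e → (k :* (f :* z)) :* e := (k :* f) :* (e :* z)) refl _ _ _ e ⟩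
    (fromℕ (suc n) * fromℕ (n ℕ.!)) * (e * e ^ n)
      ≈⟨ *-congʳ (×1-homo-* (suc n) (n ℕ.!)) ⟨
    fromℕ (suc n ℕ.!) * e ^ suc n
      ∎

  -- Complex numbers and roots

  ℂ-isCommutativeRing : IsCommutativeRing _≈ᶜ_ _+ᶜ_ (RawRing._*_ ℂ-rawRing) -ᶜ_ 0ᶜ (RawRing.1# ℂ-rawRing)
  ℂ-isCommutativeRing = record
    { isRing = record
      { +-isAbelianGroup = record
        { isGroup = record
          { isMonoid = record
            { isSemigroup = record
              { isMagma = record
                { isEquivalence = record
                  { refl  = refl , refl
                  ; sym   = λ (p , q) → sym p , sym q
                  ; trans = λ (p , q) (p′ , q′) → trans p p′ , trans q q′
                  }
                ; ∙-cong = λ (p , q) (p′ , q′) → +-cong p p′ , +-cong q q′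
                }
              ; assoc = λ _ _ _ → +-assoc _ _ _ , +-assoc _ _ _
              }
            ; identity = (λ _ → +-identityˡ _ , +-identityˡ _)
                       , (λ _ → +-identityʳ _ , +-identityʳ _)
            }
          ; inverse = (λ _ → -‿inverseˡ _ , -‿inverseˡ _)
                    , (λ _ → -‿inverseʳ _ , -‿inverseʳ _)
          ; ⁻¹-cong = λ (p , q) → -‿cong p , -‿cong q
          }
        ; comm = λ _ _ → +-comm _ _ , +-comm _ _
        }
      ; *-cong = λ (p , q) (p′ , q′) →
          +-cong (*-cong p p′) (-‿cong (*-cong q q′)) , +-cong (*-cong p q′) (*-cong q p′)
      ; *-assoc = λ (a +i b) (c +i d) (u +i v) →
          solve 6 (λ a b c d u v →
            (a :* c :- b :* d) :* u :- (a :* d :+ b :* c) :* v :=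
            a :* (c :* u :- d :* v) :- b :* (c :* v :+ d :* u)) refl a b c d u v ,
          solve 6 (λ a b c d u v →
            (a :* c :- b :* d) :* v :+ (a :* d :+ b :* c) :* u :=
            a :* (c :* v :+ d :* u) :+ b :* (c :* u :- d :* v)) refl a b c d u v
      ; *-identity =
          (λ (a +i b) → solve 2 (λ a b → :1 :* a :- :0 :* b := a) refl a b ,
                        solve 2 (λ a b → :1 :* b :+ :0 :* a := b) refl a b) ,
          (λ (a +i b) → solve 2 (λ a b → a :* :1 :- b :* :0 := a) refl a b ,
                        solve 2 (λ a b → a :* :0 :+ b :* :1 := b) refl a b)
      ; distrib =
          (λ (a +i b) (c +i d) (u +i v) →
            solve 6 (λ a b c d u v →
              a :* (c :+ u) :- b :* (d :+ v) :=
              (a :* c :- b :* d) :+ (a :* u :- b :* v)) refl a b c d u v ,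
            solve 6 (λ a b c d u v →
              a :* (d :+ v) :+ b :* (c :+ u) :=
              (a :* d :+ b :* c) :+ (a :* v :+ b :* u)) refl a b c d u v) ,
          (λ (a +i b) (c +i d) (u +i v) →
            solve 6 (λ a b c d u v →
              (c :+ u) :* a :- (d :+ v) :* b :=
              (c :* a :- d :* b) :+ (u :* a :- v :* b)) refl a b c d u v ,
            solve 6 (λ a b c d u v →
              (c :+ u) :* b :+ (d :+ v) :* a :=
              (c :* b :+ d :* a) :+ (u :* b :+ v :* a)) refl a b c d u v)
      }
    ; *-comm = λ (a +i b) (c +i d) →
        solve 4 (λ a b c d → a :* c :- b :* d := c :* a :- d :* b) refl a b c d ,
        solve 4 (λ a b c d → a :* d :+ b :* c := c :* b :+ d :* a) refl a b c d
    }

  ℂ-commutativeRing : CommutativeRing 0ℓ 0ℓ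
  ℂ-commutativeRing = record { isCommutativeRing = ℂ-isCommutativeRing }

  module ℂᵣ = CommutativeRing ℂ-commutativeRing
  open PolynomialEvaluation ℂ-commutativeRing

  ∣_∣² : ℂ → ℝ
  ∣ z ∣² = re z * re z + im z * im z

  0≤∣z∣² : ∀ z → 0# ≤ ∣ z ∣²
  0≤∣z∣² z = +-nonNeg (0≤x² (re z)) (0≤x² (im z))

  ∣z∣²≈0⇒z≈0 : ∀ z → ∣ z ∣² ≈ 0# → z ≈ᶜ 0ᶜ
  ∣z∣²≈0⇒z≈0 (a +i b) N≈0 =
    square≈0 (≤-by (0≤x² b) refl) , square≈0 (≤-by (0≤x² a) (+-comm _ _))
    where
    square≈0 : ∀ {x} → x * x ≤ a * a + b * b → x ≈ 0#
    square≈0 {x} x²≤N = reduce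
      (no-zero-divisors (antisym (≤-respʳ-≈ N≈0 x²≤N) (0≤x² x)))

  -- The squared modulus is multiplicative by the two-square identity, so a vanishing product in ℂ
  -- gives a vanishing product of two reals.
  ℂ-integral : ∀ z w → z ℂᵣ.* w ≈ᶜ 0ᶜ → z ≈ᶜ 0ᶜ ⊎ w ≈ᶜ 0ᶜ
  ℂ-integral z@(a +i b) w@(c +i d) (re≈0 , im≈0) =
    case no-zero-divisors ∣z∣²∣w∣²≈0 of λ where
      (inj₁ N≈0) → inj₁ (∣z∣²≈0⇒z≈0 z N≈0)
      (inj₂ N≈0) → inj₂ (∣z∣²≈0⇒z≈0 w N≈0)
    where
    ∣z∣²∣w∣²≈0 : ∣ z ∣² * ∣ w ∣² ≈ 0#
    ∣z∣²∣w∣²≈0 = begin-equality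
      (a * a + b * b) * (c * c + d * d)
        ≈⟨ solve 4 (λ a b c d → (a :* a :+ b :* b) :* (c :* c :+ d :* d) :=
             (a :* c :- b :* d) :* (a :* c :- b :* d) :+
             (a :* d :+ b :* c) :* (a :* d :+ b :* c)) refl a b c d ⟩
      ∣ z ℂᵣ.* w ∣²
        ≈⟨ +-cong (*-cong re≈0 re≈0) (*-cong im≈0 im≈0) ⟩
      0# * 0# + 0# * 0#
        ≈⟨ solve 0 (:0 :* :0 :+ :0 :* :0 := :0) refl ⟩
      0#
        ∎

  IsRoot⇒∈ : ∀ f αs {z} → HasRoots f αs → IsRoot f z → Any (z ≈ᶜ_) αs
  IsRoot⇒∈ f αs {z} f≋αs fz≈0 = eval-fromRoots≈0⇒∈ (λ (1≈0 , _) → 0≉1 (sym 1≈0)) ℂ-integral αs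
    (ℂᵣ.trans (ℂᵣ.sym (eval-cong (toℂ[x] f) (ℂ[x].fromRoots αs) z f≋αs)) fz≈0)

  ∈⇒IsRoot : ∀ f αs {z} → HasRoots f αs → Any (z ≈ᶜ_) αs → IsRoot f z
  ∈⇒IsRoot f αs {z} f≋αs z∈αs =
    ℂᵣ.trans (eval-cong (toℂ[x] f) (ℂ[x].fromRoots αs) z f≋αs) (∈⇒eval-fromRoots≈0 z∈αs)

  ∣z∣-nonNeg : ∀ z → 0# ≤ ∣ z ∣
  ∣z∣-nonNeg z = √-nonNeg (0≤∣z∣² z)

  ∣z∣-square : ∀ z → ∣ z ∣ * ∣ z ∣ ≈ ∣ z ∣²
  ∣z∣-square z = √-square (0≤∣z∣² z)

  ∣∣-cong-² : ∀ {z w} → ∣ z ∣² ≈ ∣ w ∣² → ∣ z ∣ ≈ ∣ w ∣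
  ∣∣-cong-² {z} {w} eq = antisym (≤-half z w eq) (≤-half w z (sym eq))
    where
    ≤-half : ∀ z w → ∣ z ∣² ≈ ∣ w ∣² → ∣ z ∣ ≤ ∣ w ∣
    ≤-half z w eq = x²≤y²⇒x≤y (∣z∣-nonNeg w) (≤-reflexive
      (trans (∣z∣-square z) (trans eq (sym (∣z∣-square w)))))

  ∣∣-cong : ∀ {z w} → z ≈ᶜ w → ∣ z ∣ ≈ ∣ w ∣
  ∣∣-cong (p , q) = ∣∣-cong-² (+-cong (*-cong p p) (*-cong q q))

  ∣conj∣ : ∀ z → ∣ conj z ∣ ≈ ∣ z ∣
  ∣conj∣ (a +i b) = ∣∣-cong-² (solve 2 (λ a b → a :* a :+ :- b :* :- b := a :* a :+ b :* b) refl a b)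

  the-junk : ∀ (P : ℝ → Set) → ¬ ∃ P → the P ≈ 0#
  the-junk P ¬∃P with lem {P = ∃ P}
  ... | yes ∃P = contradiction ∃P ¬∃P
  ... | no  _  = refl

  RootDistance-nonNeg : ∀ {f d} → RootDistance f d → 0# ≤ d
  RootDistance-nonNeg (_ , _ , _ , _ , _ , d≈) = ≤-respʳ-≈ (sym d≈) (∣z∣-nonNeg _)

  -- If f had no closest pair of distinct roots, sep f would be the junk value 0,
  -- so the existence of a minimum is irrelevant.
  sep-spec : ∀ f → 0# ≤ sep f × (∀ d → RootDistance f d → sep f ≤ d)
  sep-spec f = case lem {P = ∃ P} of λ where
      (yes min) → let sep-min = the-satisfies P min in
                  RootDistance-nonNeg {f} (proj₁ sep-min) , proj₂ sep-min
      (no ¬min) → let sep≈0 = the-junk P ¬min in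
                  ≤-reflexive (sym sep≈0) , λ d dist →
                  ≤-trans (≤-reflexive sep≈0) (RootDistance-nonNeg {f} dist)
    where
    P : ℝ → Set
    P = IsMinimum (RootDistance f)

  -- Separation and Mahler measure

  -- Squared distances are polynomials in the coordinates, so the estimates built on this bound
  -- become ring identities with nonnegative remainders.
  sep²-≤ : ∀ {f α β} → IsRoot f α → IsRoot f β → ¬ (α ≈ᶜ β) →
           sep f * sep f ≤ ∣ α +ᶜ (-ᶜ β) ∣²
  sep²-≤ {f} {α} {β} α-root β-root α≉β = begin
    sep f * sep f                            ≤⟨ *-mono-≤ 0≤sep (∣z∣-nonNeg α-β) sep≤ sep≤ ⟩
    ∣ α-β ∣ * ∣ α-β ∣                        ≈⟨ ∣z∣-square α-β ⟩
    ∣ α-β ∣²                                 ∎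
    where
    α-β = α +ᶜ (-ᶜ β)
    0≤sep = proj₁ (sep-spec f)
    sep≤ = proj₂ (sep-spec f) ∣ α-β ∣ (α , β , α-root , β-root , α≉β , refl)

  mahlerFactor : ℂ → ℝ
  mahlerFactor z = 1# ⊔ ∣ z ∣

  1≤mahlerFactor : ∀ z → 1# ≤ mahlerFactor z
  1≤mahlerFactor z = x≤x⊔y 1# ∣ z ∣

  0≤mahlerFactor : ∀ z → 0# ≤ mahlerFactor z
  0≤mahlerFactor z = ≤-trans 0≤1 (1≤mahlerFactor z)

  ∣z∣≤mahlerFactor : ∀ z → ∣ z ∣ ≤ mahlerFactor z
  ∣z∣≤mahlerFactor z = x≤y⊔x 1# ∣ z ∣

  ∣z∣²≤mahlerFactor² : ∀ z → ∣ z ∣² ≤ mahlerFactor z * mahlerFactor z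
  ∣z∣²≤mahlerFactor² z = ≤-respˡ-≈ (∣z∣-square z)
    (*-mono-≤ (∣z∣-nonNeg z) (0≤mahlerFactor z) (∣z∣≤mahlerFactor z) (∣z∣≤mahlerFactor z))

  mahlerFactor-cong : ∀ {z w} → z ≈ᶜ w → mahlerFactor z ≈ mahlerFactor w
  mahlerFactor-cong z≈w = ⊔-congˡ 1# (∣∣-cong z≈w)

  mahlerFactor-conj : ∀ z → mahlerFactor (conj z) ≈ mahlerFactor z
  mahlerFactor-conj z = ⊔-congˡ 1# (∣conj∣ z)

  1≤mahlerOfRoots : ∀ αs → 1# ≤ mahlerOfRoots αs
  1≤mahlerOfRoots []       = ≤-refl
  1≤mahlerOfRoots (α ∷ αs) = begin
    1#                                 ≈⟨ *-identityʳ 1# ⟨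
    1# * 1#                            ≤⟨ *-mono-≤ 0≤1 (0≤mahlerFactor α)
                                            (1≤mahlerFactor α) (1≤mahlerOfRoots αs) ⟩
    mahlerFactor α * mahlerOfRoots αs  ∎

  mahlerOfRoots-─ : ∀ {β αs} (β∈αs : Any (β ≈ᶜ_) αs) →
                    mahlerOfRoots αs ≈ mahlerFactor β * mahlerOfRoots (αs Any.─ β∈αs)
  mahlerOfRoots-─ (here β≈α) = *-congʳ (mahlerFactor-cong (ℂᵣ.sym β≈α))
  mahlerOfRoots-─ {β} {α ∷ αs} (there β∈αs) = begin-equality
    mahlerFactor α * mahlerOfRoots αs
      ≈⟨ *-congˡ (mahlerOfRoots-─ β∈αs) ⟩
    mahlerFactor α * (mahlerFactor β * mahlerOfRoots (αs Any.─ β∈αs))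
      ≈⟨ solve 3 (λ a b m → a :* (b :* m) := b :* (a :* m)) refl _ _ _ ⟩
    mahlerFactor β * (mahlerFactor α * mahlerOfRoots (αs Any.─ β∈αs))
      ∎

  ∈-─ : ∀ {β γ αs} (β∈αs : Any (β ≈ᶜ_) αs) → ¬ (β ≈ᶜ γ) →
        Any (γ ≈ᶜ_) αs → Any (γ ≈ᶜ_) (αs Any.─ β∈αs)
  ∈-─ (here β≈α)   β≉γ (here γ≈α)   = contradiction (ℂᵣ.trans β≈α (ℂᵣ.sym γ≈α)) β≉γ
  ∈-─ (here β≈α)   β≉γ (there γ∈αs) = γ∈αs
  ∈-─ (there β∈αs) β≉γ (here γ≈α)   = here γ≈α
  ∈-─ (there β∈αs) β≉γ (there γ∈αs) = there (∈-─ β∈αs β≉γ γ∈αs)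

  Distinct : List ℂ → Set
  Distinct = AllPairs (λ α β → ¬ (α ≈ᶜ β))

  -- Each β is matched with an entry of `αs`, which is then removed. Since the later members of `βs`
  -- differ from β, they still occur among the remaining entries, and entries left over at the end
  -- contribute factors at least 1.
  mahlerOfRoots-⊆ : ∀ {βs αs} → Distinct βs → All (λ β → Any (β ≈ᶜ_) αs) βs →
                    mahlerOfRoots βs ≤ mahlerOfRoots αs
  mahlerOfRoots-⊆ {[]}     {αs} [] [] = 1≤mahlerOfRoots αs
  mahlerOfRoots-⊆ {β ∷ βs} {αs} (β≉βs ∷ distinct) (β∈αs ∷ βs⊆αs) = begin
    mahlerFactor β * mahlerOfRoots βs
      ≤⟨ *-monoʳ-≤ (0≤mahlerFactor β) (mahlerOfRoots-⊆ distinct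
           (All.zipWith (λ (β≉γ , γ∈αs) → ∈-─ β∈αs β≉γ γ∈αs) (β≉βs , βs⊆αs))) ⟩
    mahlerFactor β * mahlerOfRoots (αs Any.─ β∈αs)
      ≈⟨ mahlerOfRoots-─ β∈αs ⟨
    mahlerOfRoots αs
      ∎

  -- The root list chosen by M f need not be the given one, but it contains every root.
  mahlerOfRoots≤M : ∀ f αs {βs} → HasRoots f αs → All (IsRoot f) βs → Distinct βs →
                    mahlerOfRoots βs ≤ M f
  mahlerOfRoots≤M f αs f≋αs βs-roots distinct =
    let αs′ , f≋αs′ , M≈ = the-satisfies
          (λ m → ∃[ αs ] HasRoots f αs × m ≈ mahlerOfRoots αs) (mahlerOfRoots αs , αs , f≋αs , refl)
    in ≤-respʳ-≈ (sym M≈)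
         (mahlerOfRoots-⊆ distinct (All.map (IsRoot⇒∈ f αs′ f≋αs′) βs-roots))

  0≤M : ∀ f αs → HasRoots f αs → 0# ≤ M f
  0≤M f αs f≋αs = ≤-trans 0≤1 (mahlerOfRoots≤M f αs {[]} f≋αs [] [])

  -- Totally real polynomials

  -- One round of selection sort. The key is a parameter because `packing` peels off the largest
  -- real, while `gap-≤-mahlerOfRoots` peels off the root of largest modulus.
  extractMax : ∀ {A : Set} (key : A → ℝ) x xs →
               ∃₂ λ y ys → (x ∷ xs) ↭ (y ∷ ys) × All (λ z → key z ≤ key y) ys
  extractMax key x [] = x , [] , ↭.refl , []
  extractMax key x (x′ ∷ xs) =
    let y , ys , perm , max = extractMax key x′ xs
    in case total (key x) (key y) of λ where
      (inj₁ x≤y) → y , x ∷ ys , ↭.trans (↭.prep x perm) (↭.swap x y ↭.refl) , x≤y ∷ max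
      (inj₂ y≤x) → x , y ∷ ys , ↭.prep x perm , y≤x ∷ All.map (λ z≤y → ≤-trans z≤y y≤x) max

  AllPairs-resp-↭ : ∀ {A : Set} {_∼_ : Rel A 0ℓ} → Symmetric _∼_ → ∀ {xs ys} →
                    xs ↭ ys → AllPairs _∼_ xs → AllPairs _∼_ ys
  AllPairs-resp-↭ {A} {_∼_} ∼-sym xs↭ys =
    ↭ₛ.AllPairs-resp-↭ (≡.setoid A) ∼-sym (≡.resp₂ _∼_) (↭⇒↭ₛ xs↭ys)

  -- The squared form is symmetric in x and y without absolute values, and symmetry lets pairwise
  -- separation survive the reordering by `extractMax`.
  Apart : ℝ → ℝ → ℝ → Set
  Apart d x y = d * d ≤ (x - y) * (x - y)

  Apart-sym : ∀ {d} → Symmetric (Apart d)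
  Apart-sym {x = x} {y} = ≤-respʳ-≈
    (solve 2 (λ x y → (x :- y) :* (x :- y) := (y :- x) :* (y :- x)) refl x y)

  -- Remove the largest point y: the remaining points are at least d away from it, hence lie between
  -- l and y - d, and the induction continues in that shorter interval.
  packing : ∀ {d l u} n xs → length xs ≡ suc n → AllPairs (Apart d) xs →
            All (l ≤_) xs → All (_≤ u) xs → fromℕ n * d ≤ u - l
  packing {d} {l} {u} zero (x ∷ []) _ _ (l≤x ∷ []) (x≤u ∷ []) =
    ≤-respˡ-≈ (sym (zeroˡ d)) (x≤y⇒0≤y-x (≤-trans l≤x x≤u))
  packing {d} {l} {u} (suc n) (x ∷ xs) len apart l≤xs xs≤u =
    let y , ys , perm , max = extractMax (λ x → x) x xs
        y∷ys-apart = AllPairs-resp-↭ (λ {x} {y} → Apart-sym {d} {x} {y}) perm apart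
        l≤y∷ys = All-resp-↭ perm l≤xs
        y∷ys≤u = All-resp-↭ perm xs≤u
        ys≤y-d = All.zipWith (λ {z} (y-z-apart , z≤y) →
                       ≤-by (x≤y⇒0≤y-x (x²≤y²⇒x≤y (x≤y⇒0≤y-x z≤y) y-z-apart))
                         (solve 3 (λ y z d → y :- d := z :+ ((y :- z) :- d)) refl y z d))
                       (AllPairs.head y∷ys-apart , max)
        n*d≤ = packing n ys (ℕ.suc-injective (≡.trans (≡.sym (↭-length perm)) len))
                 (AllPairs.tail y∷ys-apart) (All.tail l≤y∷ys) ys≤y-d
    in begin
      (1# + fromℕ n) * d    ≈⟨ solve 2 (λ m d → (:1 :+ m) :* d := d :+ m :* d) refl (fromℕ n) d ⟩
      d + fromℕ n * d       ≤⟨ +-monoʳ-≤ d n*d≤ ⟩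
      d + ((y - d) - l)     ≈⟨ solve 3 (λ d y l → d :+ ((y :- d) :- l) := y :- l) refl d y l ⟩
      y - l                 ≤⟨ +-monoˡ-≤ (- l) (All.head y∷ys≤u) ⟩
      u - l                 ∎

  mahlerOfRoots-↭ : ∀ {αs βs} → αs ↭ βs → mahlerOfRoots αs ≈ mahlerOfRoots βs
  mahlerOfRoots-↭ ↭.refl         = refl
  mahlerOfRoots-↭ (↭.prep α p)   = *-congˡ (mahlerOfRoots-↭ p)
  mahlerOfRoots-↭ (↭.swap α β p) = trans (*-congˡ (*-congˡ (mahlerOfRoots-↭ p)))
    (solve 3 (λ a b m → a :* (b :* m) := b :* (a :* m)) refl _ _ _)
  mahlerOfRoots-↭ (↭.trans p q)  = trans (mahlerOfRoots-↭ p) (mahlerOfRoots-↭ q)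

  re≤∣z∣ : ∀ z → re z ≤ ∣ z ∣
  re≤∣z∣ z = x²≤y²⇒x≤y (∣z∣-nonNeg z)
    (≤-respʳ-≈ (sym (∣z∣-square z)) (≤-by (0≤x² (im z)) refl))

  -∣z∣≤re : ∀ z → - ∣ z ∣ ≤ re z
  -∣z∣≤re z = ≤-respʳ-≈ (-‿involutive (re z)) (neg-mono-≤ (x²≤y²⇒x≤y (∣z∣-nonNeg z)
    (≤-respʳ-≈ (sym (∣z∣-square z)) (≤-by (0≤x² (im z))
      (solve 2 (λ a b → a :* a :+ b :* b := :- a :* :- a :+ b :* b) refl (re z) (im z))))))

  2# : ℝ
  2# = fromℕ 2

  0≤2 : 0# ≤ 2#
  0≤2 = 0≤fromℕ 2

  -- n + 1 reals with gaps at least d in [-r , r] force n d ≤ 2 r; apply this with r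
  -- the largest modulus and remove the corresponding root.
  gap-≤-mahlerOfRoots : ∀ {d} → 0# ≤ d → ∀ n zs → length zs ≡ suc n →
                        AllPairs (λ z w → Apart d (re z) (re w)) zs →
                        d ^ n * fromℕ (n ℕ.!) ≤ 2# ^ n * mahlerOfRoots zs
  gap-≤-mahlerOfRoots 0≤d zero zs len apart = begin
    1# * (1# + 0#)          ≈⟨ solve 0 (:1 :* (:1 :+ :0) := :1) refl ⟩
    1#                      ≤⟨ 1≤mahlerOfRoots zs ⟩
    mahlerOfRoots zs        ≈⟨ *-identityˡ _ ⟨
    1# * mahlerOfRoots zs   ∎
  gap-≤-mahlerOfRoots {d} 0≤d n@(suc k) (z₀ ∷ zs₀) len apart₀ =
    let z , zs , perm , max = extractMax ∣_∣ z₀ zs₀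
        apart = AllPairs-resp-↭ (λ {z} {w} → Apart-sym {d} {re z} {re w}) perm apart₀
        len-zs = ℕ.suc-injective (≡.trans (≡.sym (↭-length perm)) len)
        ∣z∣-max = ≤-refl ∷ max
        n*d≤ = packing n (map re (z ∷ zs)) (≡.trans (List.length-map re (z ∷ zs)) (≡.cong suc len-zs))
          (AllPairs.map⁺ apart)
          (All.map⁺ (All.map (λ {w} w≤z → ≤-trans (neg-mono-≤ w≤z) (-∣z∣≤re w)) ∣z∣-max))
          (All.map⁺ (All.map (λ {w} w≤z → ≤-trans (re≤∣z∣ w) w≤z) ∣z∣-max))
        m = mahlerFactor z
    in begin
      (d * d ^ k) * fromℕ (n ℕ.!)
        ≈⟨ *-congˡ (×1-homo-* n (k ℕ.!)) ⟩
      (d * d ^ k) * (fromℕ n * fromℕ (k ℕ.!))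
        ≈⟨ solve 4 (λ d w n f → (d :* w) :* (n :* f) := (n :* d) :* (w :* f)) refl d _ _ _ ⟩
      (fromℕ n * d) * (d ^ k * fromℕ (k ℕ.!))
        ≤⟨ *-mono-≤ (*-nonNeg (0≤x^n 0≤d k) (0≤fromℕ (k ℕ.!))) (*-nonNeg 0≤2 (0≤mahlerFactor z))
             (begin
               fromℕ n * d       ≤⟨ n*d≤ ⟩
               ∣ z ∣ - - ∣ z ∣   ≈⟨ solve 1 (λ r → r :- :- r := (:1 :+ (:1 :+ :0)) :* r) refl ∣ z ∣ ⟩
               2# * ∣ z ∣        ≤⟨ *-monoʳ-≤ 0≤2 (∣z∣≤mahlerFactor z) ⟩
               2# * m            ∎)
             (gap-≤-mahlerOfRoots 0≤d k zs len-zs (AllPairs.tail apart)) ⟩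
      (2# * m) * (2# ^ k * mahlerOfRoots zs)
        ≈⟨ solve 4 (λ t m p w → (t :* m) :* (p :* w) := (t :* p) :* (m :* w)) refl 2# m _ _ ⟩
      (2# * 2# ^ k) * (m * mahlerOfRoots zs)
        ≈⟨ *-congˡ (mahlerOfRoots-↭ perm) ⟨
      (2# * 2# ^ k) * mahlerOfRoots (z₀ ∷ zs₀)
        ∎

  -- The two exceptional signatures

  -- D = sep², a is the real root and b ± ci the others.  For A ≥ 2 the first bound on D
  -- suffices; for A ≤ 2, adding it to twice the second and using
  -- 2 (a - b)² ≤ 3 a² + 6 b² leaves A² - 3 A + 2 ≤ 0.
  inequality-1,1 : ∀ {D A Q a b c} →
    D ≤ fromℕ 4 * (c * c) → D ≤ (a - b) * (a - b) + c * c →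
    1# ≤ A → a * a ≤ A * A → 1# ≤ Q → b * b + c * c ≤ Q →
    D ≤ fromℕ 3 * (A * Q)
  inequality-1,1 {D} {A} {Q} {a} {b} {c} D≤4c² D≤∣a-z∣² 1≤A a²≤A² 1≤Q ∣z∣²≤Q
    with total A 2#
  ... | inj₂ 2≤A = ≤-trans D≤4c² (≤-by
    (+-nonNeg (+-nonNeg (+-nonNeg
      (*-nonNeg (0≤fromℕ 4) (x≤y⇒0≤y-x ∣z∣²≤Q))
      (*-nonNeg (0≤fromℕ 4) (0≤x² b)))
      (*-nonNeg (0≤fromℕ 3) (*-nonNeg (x≤y⇒0≤y-x 2≤A) 0≤Q)))
      (*-nonNeg 0≤2 0≤Q))
    (solve 4 (λ A Q b c →
      :fromℕ 3 :* (A :* Q) := :fromℕ 4 :* (c :* c) :+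
        (:fromℕ 4 :* (Q :- (b :* b :+ c :* c)) :+ :fromℕ 4 :* (b :* b) :+
         :fromℕ 3 :* ((A :- :fromℕ 2) :* Q) :+ :fromℕ 2 :* Q))
      refl A Q b c))
    where 0≤Q = ≤-trans 0≤1 1≤Q
  ... | inj₁ A≤2 = *-cancelˡ-≤ (0<fromℕ 3) (≤-by
    (+-nonNeg (+-nonNeg (+-nonNeg (+-nonNeg (+-nonNeg (+-nonNeg
      (*-nonNeg 0≤2 (x≤y⇒0≤y-x D≤∣a-z∣²))
      (x≤y⇒0≤y-x D≤4c²))
      (0≤x² (a + 2# * b)))
      (*-nonNeg (0≤fromℕ 6) (x≤y⇒0≤y-x ∣z∣²≤Q)))
      (*-nonNeg (0≤fromℕ 3) (x≤y⇒0≤y-x a²≤A²)))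
      (*-nonNeg (0≤fromℕ 3) (*-nonNeg (0≤x² A) (x≤y⇒0≤y-x 1≤Q))))
      (*-nonNeg (0≤fromℕ 3) (*-nonNeg (*-nonNeg (≤-trans 0≤1 1≤Q) (x≤y⇒0≤y-x 1≤A)) (x≤y⇒0≤y-x A≤2))))
    (solve 6 (λ D A Q a b c →
      :fromℕ 3 :* (:fromℕ 3 :* (A :* Q)) := :fromℕ 3 :* D :+
        (:fromℕ 2 :* (((a :- b) :* (a :- b) :+ c :* c) :- D) :+
         (:fromℕ 4 :* (c :* c) :- D) :+
         (a :+ :fromℕ 2 :* b) :* (a :+ :fromℕ 2 :* b) :+
         :fromℕ 6 :* (Q :- (b :* b :+ c :* c)) :+
         :fromℕ 3 :* (A :* A :- a :* a) :+
         :fromℕ 3 :* ((A :* A) :* (Q :- :1)) :+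
         :fromℕ 3 :* ((Q :* (A :- :1)) :* (:fromℕ 2 :- A))))
      refl D A Q a b c))

  private
    module _ {D Z W a b c d : ℝ} (0≤D : 0# ≤ D) (1≤Z : 1# ≤ Z) (1≤W : 1# ≤ W)
             (D≤4b² : D ≤ fromℕ 4 * (b * b)) (D≤4d² : D ≤ fromℕ 4 * (d * d))
             (∣z∣²≤Z² : a * a + b * b ≤ Z * Z) (∣w∣²≤W² : c * c + d * d ≤ W * W) where
      S = Z * Z + W * W

      4b²≤4Z² : fromℕ 4 * (b * b) ≤ fromℕ 4 * (Z * Z)
      4b²≤4Z² = *-monoʳ-≤ (0≤fromℕ 4) (≤-trans (≤-by (0≤x² a) (+-comm _ _)) ∣z∣²≤Z²)

      4d²≤4W² : fromℕ 4 * (d * d) ≤ fromℕ 4 * (W * W)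
      4d²≤4W² = *-monoʳ-≤ (0≤fromℕ 4) (≤-trans (≤-by (0≤x² c) (+-comm _ _)) ∣w∣²≤W²)

      0<2Z : 0# < 2# * Z
      0<2Z = *-pos (0<fromℕ 2) (begin-strict
        0# <⟨ 0<1 ⟩
        1# ≤⟨ 1≤Z ⟩
        Z  ∎)

      0<2W : 0# < 2# * W
      0<2W = *-pos (0<fromℕ 2) (begin-strict
        0# <⟨ 0<1 ⟩
        1# ≤⟨ 1≤W ⟩
        W  ∎)

      -- If g = D - 2 Z W were positive, then 0 ≤ 3 D - 2 S ≤ - 4 a c would give
      -- (3 D - 2 S)² ≤ (4 Z² - D) (4 W² - D), but the left side exceeds the right by
      -- 4 (W - Z)⁴ + 8 g (4 Z W - S) + 8 g² > 0.
      inequality-0,2⁺ : 0# ≤ b * d → D ≤ (a - c) * (a - c) + (b - d) * (b - d) →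
                          D ≤ 2# * (Z * W)
      inequality-0,2⁺ 0≤bd D≤∣z-w∣² = ≤-stable λ 2ZW<D →
        let g = D - 2# * (Z * W)
            0<g = x<y⇒0<y-x 2ZW<D
            -- As D exceeds 2 Z W but is at most 4 Z² and 4 W², neither of Z and W is more than
            -- twice the other. This is what gives 2 S ≤ 5 Z W.
            W≤2Z : W ≤ 2# * Z
            W≤2Z = *-cancelˡ-≤ 0<2Z (begin
              (2# * Z) * W           ≈⟨ *-assoc 2# Z W ⟩
              2# * (Z * W)           ≤⟨ proj₁ 2ZW<D ⟩
              D                      ≤⟨ ≤-trans D≤4b² 4b²≤4Z² ⟩
              fromℕ 4 * (Z * Z)      ≈⟨ solve 1 (λ Z → :fromℕ 4 :* (Z :* Z) :=
                                          (:fromℕ 2 :* Z) :* (:fromℕ 2 :* Z)) refl Z ⟩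
              (2# * Z) * (2# * Z)    ∎)
            Z≤2W : Z ≤ 2# * W
            Z≤2W = *-cancelˡ-≤ 0<2W (begin
              (2# * W) * Z           ≈⟨ solve 2 (λ Z W → (:fromℕ 2 :* W) :* Z := :fromℕ 2 :* (Z :* W)) refl Z W ⟩
              2# * (Z * W)           ≤⟨ proj₁ 2ZW<D ⟩
              D                      ≤⟨ ≤-trans D≤4d² 4d²≤4W² ⟩
              fromℕ 4 * (W * W)      ≈⟨ solve 1 (λ Z → :fromℕ 4 :* (Z :* Z) :=
                                          (:fromℕ 2 :* Z) :* (:fromℕ 2 :* Z)) refl W ⟩
              (2# * W) * (2# * W)    ∎)
            0≤ZW = *-nonNeg (≤-trans 0≤1 1≤Z) (≤-trans 0≤1 1≤W)
            2S≤5ZW : 2# * S ≤ fromℕ 5 * (Z * W)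
            2S≤5ZW = ≤-by (*-nonNeg (x≤y⇒0≤y-x W≤2Z) (x≤y⇒0≤y-x Z≤2W))
              (solve 2 (λ Z W → :fromℕ 5 :* (Z :* W) :=
                :fromℕ 2 :* (Z :* Z :+ W :* W) :+
                (:fromℕ 2 :* Z :- W) :* (:fromℕ 2 :* W :- Z)) refl Z W)
            -- The geometric mean of D ≤ 4 b² and D ≤ 4 d², with b d ≥ 0 fixing the sign of the
            -- root.
            D≤4bd : D ≤ fromℕ 4 * (b * d)
            D≤4bd = x²≤y²⇒x≤y (*-nonNeg (0≤fromℕ 4) 0≤bd) (begin
              D * D                                      ≤⟨ *-mono-≤ 0≤D (≤-trans 0≤D D≤4b²) D≤4b² D≤4d² ⟩
              (fromℕ 4 * (b * b)) * (fromℕ 4 * (d * d))  ≈⟨ solve 3 (λ k b d →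
                (k :* (b :* b)) :* (k :* (d :* d)) := (k :* (b :* d)) :* (k :* (b :* d))) refl (fromℕ 4) b d ⟩
              (fromℕ 4 * (b * d)) * (fromℕ 4 * (b * d))  ∎)
            H = fromℕ 3 * D - 2# * S
            U = fromℕ 4 * (Z * Z) - D
            V = fromℕ 4 * (W * W) - D
            4ac = fromℕ 4 * (a * c)
            0≤H : 0# ≤ H
            0≤H = ≤-respʳ-≈
              (solve 4 (λ D P S g → :fromℕ 3 :* (D :- :fromℕ 2 :* P) :+
                   ((:fromℕ 5 :* P :- :fromℕ 2 :* S) :+ P) := :fromℕ 3 :* D :- :fromℕ 2 :* S)
                refl D (Z * W) S g)
              (+-nonNeg (*-nonNeg (0≤fromℕ 3) (proj₁ 0<g)) (+-nonNeg (x≤y⇒0≤y-x 2S≤5ZW) 0≤ZW))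
            -- Twice the bound by the distance from z to w has cross terms - 4 a c - 4 b d; adding D
            -- ≤ 4 b d cancels the second and leaves 3 D ≤ 2 S - 4 a c.
            H≤-4ac : H ≤ - 4ac
            H≤-4ac = ≤-by
              (+-nonNeg (+-nonNeg
                (*-nonNeg 0≤2 (x≤y⇒0≤y-x D≤∣z-w∣²))
                (x≤y⇒0≤y-x D≤4bd))
                (*-nonNeg 0≤2 (+-nonNeg (x≤y⇒0≤y-x ∣z∣²≤Z²) (x≤y⇒0≤y-x ∣w∣²≤W²))))
              (solve 7 (λ D Z W a b c d →
                :- (:fromℕ 4 :* (a :* c)) :=
                (:fromℕ 3 :* D :- :fromℕ 2 :* (Z :* Z :+ W :* W)) :+
                (:fromℕ 2 :* (((a :- c) :* (a :- c) :+ (b :- d) :* (b :- d)) :- D) :+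
                 (:fromℕ 4 :* (b :* d) :- D) :+
                 :fromℕ 2 :* ((Z :* Z :- (a :* a :+ b :* b)) :+ (W :* W :- (c :* c :+ d :* d)))))
                refl D Z W a b c d)
            4a²≤U : fromℕ 4 * (a * a) ≤ U
            4a²≤U = ≤-by (+-nonNeg (*-nonNeg (0≤fromℕ 4) (x≤y⇒0≤y-x ∣z∣²≤Z²)) (x≤y⇒0≤y-x D≤4b²))
              (solve 4 (λ D Z a b → :fromℕ 4 :* (Z :* Z) :- D := :fromℕ 4 :* (a :* a) :+
                (:fromℕ 4 :* (Z :* Z :- (a :* a :+ b :* b)) :+ (:fromℕ 4 :* (b :* b) :- D))) refl D Z a b)
            4c²≤V : fromℕ 4 * (c * c) ≤ V
            4c²≤V = ≤-by (+-nonNeg (*-nonNeg (0≤fromℕ 4) (x≤y⇒0≤y-x ∣w∣²≤W²)) (x≤y⇒0≤y-x D≤4d²))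
              (solve 4 (λ D Z a b → :fromℕ 4 :* (Z :* Z) :- D := :fromℕ 4 :* (a :* a) :+
                (:fromℕ 4 :* (Z :* Z :- (a :* a :+ b :* b)) :+ (:fromℕ 4 :* (b :* b) :- D))) refl D W c d)
            0≤4x² : ∀ x → 0# ≤ fromℕ 4 * (x * x)
            0≤4x² x = *-nonNeg (0≤fromℕ 4) (0≤x² x)
            H²≤UV : H * H ≤ U * V
            H²≤UV = begin
              H * H          ≤⟨ *-mono-≤ 0≤H (≤-trans 0≤H H≤-4ac) H≤-4ac H≤-4ac ⟩
              - 4ac * - 4ac  ≈⟨ solve 3 (λ k a c → :- (k :* (a :* c)) :* :- (k :* (a :* c)) :=
                                  (k :* (a :* a)) :* (k :* (c :* c))) refl (fromℕ 4) a c ⟩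
              (fromℕ 4 * (a * a)) * (fromℕ 4 * (c * c))
                             ≤⟨ *-mono-≤ (0≤4x² c) (≤-trans (0≤4x² a) 4a²≤U) 4a²≤U 4c²≤V ⟩
              U * V          ∎
            UV<H² : U * V < H * H
            UV<H² = <-by
              (begin-strict
                0#                                       <⟨ *-pos (0<fromℕ 8) (*-pos 0<g 0<g) ⟩
                -- The term 8 g (4 Z W - S) is split as 4 g ((5 Z W - 2 S) + 3 Z W), where both
                -- summands are visibly nonnegative; strictness comes from g² alone.
                fromℕ 8 * (g * g)                        ≤⟨ ≤-by (*-nonNeg (0≤fromℕ 4) (+-nonNeg
                   (0≤x² ((W - Z) * (W - Z)))
                   (*-nonNeg (proj₁ 0<g) (+-nonNeg (x≤y⇒0≤y-x 2S≤5ZW) (*-nonNeg (0≤fromℕ 3) 0≤ZW))))) refl ⟩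
                fromℕ 8 * (g * g) + fromℕ 4 * ((W - Z) * (W - Z) * ((W - Z) * (W - Z)) +
                  g * ((fromℕ 5 * (Z * W) - 2# * S) + fromℕ 3 * (Z * W))) ∎)
              (solve 3 (λ D Z W →
                let S = Z :* Z :+ W :* W
                    g = D :- :fromℕ 2 :* (Z :* W)
                    H = :fromℕ 3 :* D :- :fromℕ 2 :* S
                in H :* H :=
                  (:fromℕ 4 :* (Z :* Z) :- D) :* (:fromℕ 4 :* (W :* W) :- D) :+
                  (:fromℕ 8 :* (g :* g) :+ :fromℕ 4 :* ((W :- Z) :* (W :- Z) :* ((W :- Z) :* (W :- Z)) :+
                    g :* ((:fromℕ 5 :* (Z :* W) :- :fromℕ 2 :* S) :+ :fromℕ 3 :* (Z :* W)))))
                refl D Z W)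
        in <⇒≱ UV<H² H²≤UV

  -- Replacing w by its conjugate flips the sign of b d, exchanges the two distance bounds and
  -- preserves the rest, so one may assume b d ≥ 0.
  inequality-0,2 : ∀ {D Z W a b c d} → 0# ≤ D → 1# ≤ Z → 1# ≤ W →
    D ≤ fromℕ 4 * (b * b) → D ≤ fromℕ 4 * (d * d) →
    a * a + b * b ≤ Z * Z → c * c + d * d ≤ W * W →
    D ≤ (a - c) * (a - c) + (b - d) * (b - d) →
    D ≤ (a - c) * (a - c) + (b - - d) * (b - - d) →
    D ≤ 2# * (Z * W)
  inequality-0,2 {b = b} {c} {d} 0≤D 1≤Z 1≤W D≤4b² D≤4d² ∣z∣²≤Z² ∣w∣²≤W² D≤∣z-w∣² D≤∣z-w̄∣² =
    case total 0# (b * d) of λ where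
      (inj₁ 0≤bd) → inequality-0,2⁺ 0≤D 1≤Z 1≤W D≤4b² D≤4d² ∣z∣²≤Z² ∣w∣²≤W² 0≤bd D≤∣z-w∣²
      (inj₂ bd≤0) → inequality-0,2⁺ 0≤D 1≤Z 1≤W D≤4b²
        (≤-respʳ-≈ (*-congˡ d²≈) D≤4d²) ∣z∣²≤Z² (≤-respˡ-≈ (+-congˡ d²≈) ∣w∣²≤W²)
        (≤-respʳ-≈ (solve 2 (λ b d → :- (b :* d) := b :* :- d) refl b d) (x≤0⇒0≤-x bd≤0)) D≤∣z-w̄∣²
    where
    d²≈ : d * d ≈ - d * - d
    d²≈ = solve 1 (λ d → d :* d := :- d :* :- d) refl d

  -- Distinctness of conjugate roots and the bounds for signatures (1,1) and (0,2)

  x≈-x⇒x≈0 : ∀ {x} → x ≈ - x → x ≈ 0#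
  x≈-x⇒x≈0 {x} x≈-x = x*y≈0⇒y≈0 (fromℕ≉0 2) (begin-equality
    2# * x   ≈⟨ solve 1 (λ x → :fromℕ 2 :* x := x :+ x) refl x ⟩
    x + x    ≈⟨ +-congˡ x≈-x ⟩
    x - x    ≈⟨ -‿inverseʳ x ⟩
    0#       ∎)

  z≉conj : ∀ {z} → ¬ (im z ≈ 0#) → ¬ (z ≈ᶜ conj z)
  z≉conj im≉0 (_ , im≈-im) = im≉0 (x≈-x⇒x≈0 im≈-im)

  ≈conj-swap : ∀ {z w} → z ≈ᶜ conj w → conj z ≈ᶜ w
  ≈conj-swap (re≈ , im≈) = re≈ , trans (-‿cong im≈) (-‿involutive _)

  conj-cong : ∀ {z w} → z ≈ᶜ w → conj z ≈ᶜ conj w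
  conj-cong (re≈ , im≈) = re≈ , -‿cong im≈

  sep²≤4im² : ∀ {f z} → IsRoot f z → IsRoot f (conj z) → ¬ (im z ≈ 0#) →
              sep f * sep f ≤ fromℕ 4 * (im z * im z)
  sep²≤4im² {f} {z@(a +i b)} z-root z̄-root im≉0 = begin
    sep f * sep f                              ≤⟨ sep²-≤ {f} z-root z̄-root (z≉conj im≉0) ⟩
    (a - a) * (a - a) + (b - - b) * (b - - b)  ≈⟨ solve 2 (λ a b →
      (a :- a) :* (a :- a) :+ (b :- :- b) :* (b :- :- b) := :fromℕ 4 :* (b :* b)) refl a b ⟩
    fromℕ 4 * (b * b)                          ∎

  Any-trans : ∀ {x ys zs} → All (λ y → Any (y ≈ᶜ_) zs) ys → Any (x ≈ᶜ_) ys → Any (x ≈ᶜ_) zs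
  Any-trans (y∈zs ∷ _)  (here x≈y)   = Any.map (ℂᵣ.trans x≈y) y∈zs
  Any-trans (_ ∷ ys⊆zs) (there x∈ys) = Any-trans ys⊆zs x∈ys

  injective⇒≤-length : ∀ {n} {α : Fin n → ℂ} → Injective _≡_ _≈ᶜ_ α →
                       ∀ zs → (∀ i → Any (α i ≈ᶜ_) zs) → n ℕ.≤ length zs
  injective⇒≤-length {n} {α} α-injective zs α∈zs = ℕ.≮⇒≥ λ length<n →
    let i , j , i<j , same = Fin.pigeonhole length<n (λ i → Any.index (α∈zs i))
        αi≈αj = ℂᵣ.trans (Any.lookup-index (α∈zs i))
                  (ℂᵣ.trans (ℂᵣ.reflexive (≡.cong (List.lookup zs) same))
                    (ℂᵣ.sym (Any.lookup-index (α∈zs j))))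
    in Fin.<⇒≢ i<j (α-injective αi≈αj)

  √n*r-bound : ∀ {d r} n → 0# ≤ r → d * d ≤ fromℕ n * (r * r) → d ≤ √ (fromℕ n) * r
  √n*r-bound {d} {r} n 0≤r d²≤ = x²≤y²⇒x≤y (*-nonNeg (√-nonNeg (0≤fromℕ n)) 0≤r) (begin
    d * d                     ≤⟨ d²≤ ⟩
    fromℕ n * (r * r)         ≈⟨ *-congʳ (√-square (0≤fromℕ n)) ⟨
    (q * q) * (r * r)         ≈⟨ solve 2 (λ q r → (q :* q) :* (r :* r) := (q :* r) :* (q :* r)) refl q r ⟩
    (q * r) * (q * r)         ∎)
    where q = √ (fromℕ n)

  bound-1,1 : ∀ f → HasSignature f 1 1 → sep f ≤ √ (fromℕ 3) * (M f ^1/ 2)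
  bound-1,1 f (a ∷ [] , z@(b +i c) ∷ [] , im≉0 VecAll.∷ VecAll.[] , f≋αs) =
    √n*r-bound 3 (√-nonNeg (0≤M f αs f≋αs)) (begin
      sep f * sep f                        ≤⟨ inequality-1,1 (sep²≤4im² {f} z-root z̄-root im≉0) sep²≤∣x-z∣²
                                                (1≤mahlerFactor x) a²≤A² 1≤Z² (∣z∣²≤mahlerFactor² z) ⟩
      fromℕ 3 * (A * (Z * Z))              ≤⟨ *-monoʳ-≤ (0≤fromℕ 3) AZ²≤M ⟩
      fromℕ 3 * M f                        ≈⟨ *-congˡ (√-square (0≤M f αs f≋αs)) ⟨
      fromℕ 3 * (√ (M f) * √ (M f))        ∎)
    where
    αs = ofReal a ∷ z ∷ conj z ∷ []
    x = ofReal a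
    A = mahlerFactor x
    Z = mahlerFactor z
    x-root = ∈⇒IsRoot f αs f≋αs (here ℂᵣ.refl)
    z-root = ∈⇒IsRoot f αs f≋αs (there (here ℂᵣ.refl))
    z̄-root = ∈⇒IsRoot f αs f≋αs (there (there (here ℂᵣ.refl)))
    x≉z : ¬ (x ≈ᶜ z)
    x≉z (_ , 0≈c) = im≉0 (sym 0≈c)
    x≉z̄ : ¬ (x ≈ᶜ conj z)
    x≉z̄ x≈z̄ = x≉z (ℂᵣ.trans (refl , sym -0#≈0#) (≈conj-swap x≈z̄))
    sep²≤∣x-z∣² : sep f * sep f ≤ (a - b) * (a - b) + c * c
    sep²≤∣x-z∣² = ≤-respʳ-≈
      (+-congˡ (solve 1 (λ c → (:0 :- c) :* (:0 :- c) := c :* c) refl c))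
      (sep²-≤ {f} x-root z-root x≉z)
    a²≤A² : a * a ≤ A * A
    -- The squared modulus of `ofReal a` unfolds to a² + 0².
    a²≤A² = ≤-trans (≤-by (0≤x² 0#) refl) (∣z∣²≤mahlerFactor² x)
    1≤Z² : 1# ≤ Z * Z
    1≤Z² = ≤-respˡ-≈ (*-identityʳ 1#)
      (*-mono-≤ 0≤1 (0≤mahlerFactor z) (1≤mahlerFactor z) (1≤mahlerFactor z))
    AZ²≤M : A * (Z * Z) ≤ M f
    AZ²≤M = begin
      A * (Z * Z)                          ≈⟨ *-congˡ (*-congˡ (trans (*-identityʳ _) (mahlerFactor-conj z))) ⟨
      mahlerOfRoots αs  ≤⟨ mahlerOfRoots≤M f αs f≋αs
        (x-root ∷ z-root ∷ z̄-root ∷ [])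
        ((x≉z ∷ x≉z̄ ∷ []) ∷ (z≉conj im≉0 ∷ []) ∷ [] ∷ []) ⟩
      M f                                  ∎

  bound-0,2 : ∀ f → Separable 4 f → HasSignature f 0 2 → sep f ≤ √ (fromℕ 2) * (M f ^1/ 4)
  bound-0,2 f (α , α-root , α-injective)
              ([] , z@(a +i b) ∷ w@(c +i d) ∷ [] , imz≉0 VecAll.∷ imw≉0 VecAll.∷ VecAll.[] , f≋αs) =
    √n*r-bound 2 0≤r (begin
      sep f * sep f    ≤⟨ inequality-0,2 (0≤x² (sep f)) (1≤mahlerFactor z) (1≤mahlerFactor w)
                            (sep²≤4im² {f} z-root z̄-root imz≉0) (sep²≤4im² {f} w-root w̄-root imw≉0)
                            (∣z∣²≤mahlerFactor² z) (∣z∣²≤mahlerFactor² w)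
                            (sep²-≤ {f} z-root w-root z≉w) (sep²-≤ {f} z-root w̄-root z≉w̄) ⟩
      2# * (Z * W)     ≤⟨ *-monoʳ-≤ 0≤2 ZW≤r² ⟩
      2# * (r * r)     ∎)
    where
    αs = z ∷ w ∷ conj z ∷ conj w ∷ []
    Z = mahlerFactor z
    W = mahlerFactor w
    r = M f ^1/ 4
    0≤r = proj₁ (^1/-spec (0≤M f αs f≋αs) 3)
    z-root = ∈⇒IsRoot f αs f≋αs (here ℂᵣ.refl)
    w-root = ∈⇒IsRoot f αs f≋αs (there (here ℂᵣ.refl))
    z̄-root = ∈⇒IsRoot f αs f≋αs (there (there (here ℂᵣ.refl)))
    w̄-root = ∈⇒IsRoot f αs f≋αs (there (there (there (here ℂᵣ.refl))))
    -- The signature permits w to coincide with z or its conjugate, as for (x² + 1)². Separability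
    -- excludes this: four distinct roots do not fit into a list of two.
    not-collapsing : ¬ All (λ y → Any (y ≈ᶜ_) (z ∷ conj z ∷ [])) αs
    not-collapsing ys⊆ = ℕ.<⇒≱ (ℕ.s≤s (ℕ.s≤s (ℕ.s≤s ℕ.z≤n)))
      (injective⇒≤-length α-injective (z ∷ conj z ∷ [])
        (λ i → Any-trans ys⊆ (IsRoot⇒∈ f αs f≋αs (α-root i))))
    z≉w : ¬ (z ≈ᶜ w)
    z≉w z≈w = not-collapsing
      (here ℂᵣ.refl ∷ here (ℂᵣ.sym z≈w) ∷ there (here ℂᵣ.refl) ∷
       there (here (conj-cong (ℂᵣ.sym z≈w))) ∷ [])
    z≉w̄ : ¬ (z ≈ᶜ conj w)
    z≉w̄ z≈w̄ = not-collapsing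
      (here ℂᵣ.refl ∷ there (here (ℂᵣ.sym (≈conj-swap z≈w̄))) ∷ there (here ℂᵣ.refl) ∷
       here (ℂᵣ.sym z≈w̄) ∷ [])
    distinct : Distinct αs
    distinct =
      (z≉w ∷ z≉conj imz≉0 ∷ z≉w̄ ∷ []) ∷
      ((λ w≈z̄ → z≉w̄ (ℂᵣ.sym (≈conj-swap w≈z̄))) ∷ z≉conj imw≉0 ∷ []) ∷
      ((λ z̄≈w̄ → z≉w (ℂᵣ.trans (ℂᵣ.sym (≈conj-swap ℂᵣ.refl)) (≈conj-swap z̄≈w̄))) ∷ []) ∷
      [] ∷ []
    -- Conjugate roots have equal Mahler factors, so the four factors multiply to (Z W)² ≤ M f = r⁴,
    -- and one square is cancelled.
    ZW≤r² : Z * W ≤ r * r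
    ZW≤r² = x²≤y²⇒x≤y (*-nonNeg 0≤r 0≤r) (begin
      (Z * W) * (Z * W)
        ≈⟨ solve 2 (λ z w → (z :* w) :* (z :* w) := z :* (w :* (z :* (w :* :1)))) refl Z W ⟩
      Z * (W * (Z * (W * 1#)))
        ≈⟨ *-congˡ (*-congˡ (*-cong (mahlerFactor-conj z) (*-congʳ (mahlerFactor-conj w)))) ⟨
      mahlerOfRoots αs
        ≤⟨ mahlerOfRoots≤M f αs f≋αs (z-root ∷ w-root ∷ z̄-root ∷ w̄-root ∷ []) distinct ⟩
      M f
        ≈⟨ proj₂ (^1/-spec (0≤M f αs f≋αs) 3) ⟨
      r ^ 4
        ≈⟨ solve 1 (λ r → r :^ 4 := (r :* r) :* (r :* r)) refl r ⟩
      (r * r) * (r * r)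
        ∎)

  -- The bound for totally real polynomials

  ∈-reals⇒im≈0 : ∀ {z} xs → Any (z ≈ᶜ_) (map ofReal xs ++ []) → im z ≈ 0#
  ∈-reals⇒im≈0 (x ∷ xs) (here (_ , im≈0)) = im≈0
  ∈-reals⇒im≈0 (x ∷ xs) (there z∈xs)      = ∈-reals⇒im≈0 xs z∈xs

  -- After multiplication by t = n and passage to m-th powers with m = n - 1, the two estimates tᵐ ≤
  -- m! eᵐ and dᵐ m! ≤ 2ᵐ M meet in the common factor m!, so the factorial disappears without a
  -- division.
  bound-totallyReal : ∀ k f → let n = suc (suc k) in Separable n f → HasSignature f n 0 →
                      sep f ≤ ((2# * e + 0#) / fromℕ n) * (M f ^1/ suc k)
  bound-totallyReal k f (α , α-root , α-injective) (xs , [] , VecAll.[] , f≋αs) =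
    *-cancelˡ-≤ (0<fromℕ (suc m)) (begin
      t * d              ≤⟨ ^-cancelˡ-≤ k (*-nonNeg (*-nonNeg 0≤2 0≤e) 0≤r) [td]^m≤[2er]^m ⟩
      (2# * e) * r       ≈⟨ *-congʳ (+-identityʳ _) ⟨
      (2# * e + 0#) * r  ≈⟨ *-congʳ (/-spec (2# * e + 0#) (fromℕ≉0 (suc m))) ⟨
      ((2# * e + 0#) / t) * t * r
                         ≈⟨ solve 3 (λ c t r → c :* t :* r := t :* (c :* r)) refl _ t r ⟩
      t * (((2# * e + 0#) / t) * r) ∎)
    where
    αs = map ofReal (Vec.toList xs) ++ []
    m = suc k
    t = fromℕ (suc m)
    d = sep f
    r = M f ^1/ m
    0≤r = proj₁ (^1/-spec (0≤M f αs f≋αs) k)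
    -- The roots are taken from separability, where their distinctness is part of the data; the list
    -- from the signature shows that they are real.
    zs = List.tabulate α
    im≈0 : ∀ i → im (α i) ≈ 0#
    im≈0 i = ∈-reals⇒im≈0 (Vec.toList xs) (IsRoot⇒∈ f αs f≋αs (α-root i))
    gap : ∀ {i j} → ¬ (i ≡ j) → Apart d (re (α i)) (re (α j))
    gap {i} {j} i≢j = begin
      d * d
        ≤⟨ sep²-≤ {f} (α-root i) (α-root j) (i≢j ∘ α-injective {i} {j}) ⟩
      (x - y) * (x - y) + (im (α i) - im (α j)) * (im (α i) - im (α j))
        ≈⟨ +-congˡ (*-cong im-im≈0-0 im-im≈0-0) ⟩
      (x - y) * (x - y) + (0# - 0#) * (0# - 0#)
        ≈⟨ solve 1 (λ u → u :+ (:0 :- :0) :* (:0 :- :0) := u) refl _ ⟩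
      (x - y) * (x - y)
        ∎
      where
      x = re (α i)
      y = re (α j)
      im-im≈0-0 = +-cong (im≈0 i) (-‿cong (im≈0 j))
    d^m*m!≤2^m*M : d ^ m * fromℕ (m ℕ.!) ≤ 2# ^ m * M f
    d^m*m!≤2^m*M = ≤-trans
      (gap-≤-mahlerOfRoots (proj₁ (sep-spec f)) m zs (List.length-tabulate α)
        (AllPairs.tabulate⁺ {f = α} gap))
      (*-monoʳ-≤ (0≤x^n 0≤2 m) (mahlerOfRoots≤M f αs f≋αs (All.tabulate⁺ {f = α} α-root)
        (AllPairs.tabulate⁺ {f = α} (λ {i} {j} i≢j → i≢j ∘ α-injective {i} {j}))))
    [td]^m≤[2er]^m : (t * d) ^ m ≤ ((2# * e) * r) ^ m
    [td]^m≤[2er]^m = begin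
      (t * d) ^ m
        ≈⟨ ^-distrib-* t d m ⟩
      t ^ m * d ^ m
        ≤⟨ *-monoˡ-≤ (0≤x^n (proj₁ (sep-spec f)) m) ([1+n]^n≤n!*e^n m) ⟩
      (fromℕ (m ℕ.!) * e ^ m) * d ^ m
        ≈⟨ solve 3 (λ f e d → (f :* e) :* d := e :* (d :* f)) refl _ _ _ ⟩
      e ^ m * (d ^ m * fromℕ (m ℕ.!))
        ≤⟨ *-monoʳ-≤ (0≤x^n 0≤e m) d^m*m!≤2^m*M ⟩
      e ^ m * (2# ^ m * M f)
        ≈⟨ *-congˡ (*-congˡ (proj₂ (^1/-spec (0≤M f αs f≋αs) k))) ⟨
      e ^ m * (2# ^ m * r ^ m)
        ≈⟨ solve 3 (λ e t r → e :* (t :* r) := (t :* e) :* r) refl _ _ _ ⟩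
      (2# ^ m * e ^ m) * r ^ m
        ≈⟨ *-congʳ (^-distrib-* 2# e m) ⟨
      (2# * e) ^ m * r ^ m
        ≈⟨ ^-distrib-* (2# * e) r m ⟨
      ((2# * e) * r) ^ m
        ∎

  0⟶0 : (λ _ → 0#) ⟶ 0#
  0⟶0 η 0<η = 0 , λ _ _ → begin-strict
    abs (0# - 0#)  ≤⟨ ⊔-lub (≤-reflexive (-‿inverseʳ 0#))
                       (≤-reflexive (solve 0 (:- (:0 :- :0) := :0) refl)) ⟩
    0#             <⟨ 0<η ⟩
    η              ∎

theorem1p3 : (lem : ExcludedMiddle 0ℓ) (R : CompleteOrderedField) →
    let open Analysis lem R in
    Σ[ ε ∈ (ℕ → ℝ) ] (ε ⟶ 0#) ×
    (∀ (n t s : ℕ) (f : ℝ[x].Poly) →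
    2 ℕ.≤ n →
    ℝ[x].MonicOfDegree n f →
    Separable n f →
    HasSignature f t s →
    n ≡ t ℕ.+ 2 ℕ.* s →
    (c : Case t s) →
    sep f ≤ C ε c * (M f ^1/ (n ∸ δ t)))
theorem1p3 lem R = (λ _ → 0#) , 0⟶0 , bound
  where
  open RealAnalysis lem R
  bound : (n t s : ℕ) (f : ℝ[x].Poly) → 2 ℕ.≤ n → ℝ[x].MonicOfDegree n f →
          Separable n f → HasSignature f t s → n ≡ t ℕ.+ 2 ℕ.* s → (c : Case t s) →
          sep f ≤ C (λ _ → 0#) c * (M f ^1/ (n ∸ δ t))
  bound n t 0 f 2≤n _ separable signature n≡t+0 totallyReal
    -- Exposing n as `suc (suc k)` and identifying it with t makes `n ∸ δ t` reduce to `suc k`, the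
    -- order of the root in `bound-totallyReal`.
    with 2≤n | ≡.trans n≡t+0 (ℕ.+-identityʳ t)
  ... | ℕ.s≤s (ℕ.s≤s {n = k} _) | ≡.refl = bound-totallyReal k f separable signature
  bound _ _ _ f _ _ separable signature ≡.refl case-1,1 = bound-1,1 f signature
  bound _ _ _ f _ _ separable signature ≡.refl case-0,2 = bound-0,2 f separable signature
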